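{- Let $\mathbf{Q}$ be a set of qubits, $\mathbf{G}$ a set of gates (each gate $G\in\mathbf{G}$ having a duration $d_G\in\mathbb{R}_{\ge 0}$ and a tuple $(q_1,\dots,q_n)$ of distinct qubits it acts on), and $\mathbf{C}$ a set of channels. Let $\mathcal{S}$ be the symmetric monoidal category of signals over $\mathbf{C}$. Assume given a correspondence between channels and qubits (in the simplest case this could be an injection $\mathbf{Q}\to\mathbf{C}$), giving the objects $X_q$ of $\mathcal{S}$ for $q\in\mathbf{Q}$, and a pulse representation of each gate in $\mathbf{G}$, giving the morphisms $f_G$. Then $\mathcal{S}$ can be extended to a categorical model of the annotated language as follows: - For every real number $x\in\mathbb{R}$, the functor $\mathrm{Shift}(x)$ is defined by $$\mathrm{Shift}(x)[(t_1,c_1),\dots,(t_n,c_n)]:=[(t_1+x,c_1),\dots,(t_n+x,c_n)],$$ $$\mathrm{Shift}(x)(\sigma,[\phi_1,\dots,\phi_n]):=(\sigma,[\phi_1(\cdot-x),\dots,\phi_n(\cdot-x)]).$$ - For every real number $x\in\mathbb{R}$, the morphisms $\mathrm{delay}_x$ are built from the identity permutation $e\in S_1$ and the pulse $\delta_0$ which is constantly zero: $\mathrm{delay}_x=(e,[\delta_0])$.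
   Context: **Categorical model of the annotated language.** Fix $\mathbf{Q}$ and $\mathbf{G}$ as in the claim; write $(G,d,q_1,\dots,q_n)\in\mathbf{G}$ for a gate $G$ of duration $d$ acting on $(q_1,\dots,q_n)$. A categorical model $(\mathcal{C}^\otimes,X_{ - },f_{ - },\mathrm{Shift}(-),\mathrm{delay}_{ - })$ consists of: a symmetric monoidal category (SMC) $\mathcal{C}^\otimes$; for every $q\in\mathbf{Q}$ an object $X_q$ of $\mathcal{C}^\otimes$; a monoidal functor $\mathrm{Shift}(-)$ from the discrete category of real numbers (monoidal under $+$) to the category of symmetric monoidal endofunctors of $\mathcal{C}^\otimes$ (monoidal under composition); for every gate $(G,d,q_1,\dots,q_n)$ a morphism $f_G:\mathrm{Shift}(-d)(\bigotimes_{i=1}^n X_{q_i})\to\bigotimes_{i=1}^n X_{q_i}$; for every real number $x\in\mathbb{R}$ and every $q\in\mathbf{Q}$ a morphism $\mathrm{delay}_x:\mathrm{Shift}(-x)(X_q)\to X_q$. Monoidality here means that there are coherent natural isomorphisms $\mathrm{Shift}(0)(X)\simeq X$, $\mathrm{Shift}(d_1+d_2)(X)\simeq\mathrm{Shift}(d_1)(\mathrm{Shift}(d_2)(X))$, $\mathrm{Shift}(d)(I)\simeq I$, $\mathrm{Shift}(d)(X\otimes Y)\simeq\mathrm{Shift}(d)(X)\otimes\mathrm{Shift}(d)(Y)$. **The SMC of signals $\mathcal{S}$.** - Objects: finite sequences of elements of $\mathbb{R}\times\mathbf{C}$ (a starting time and a channel). - Morphisms from $X=[(s_1,c_1),\dots,(s_m,c_m)]$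 to $Y=[(t_1,d_1),\dots,(t_n,d_n)]$: none if $m\ne n$; if $m=n$, pairs $(\sigma,[\phi_1,\dots,\phi_n])$ with $\sigma\in S_n$ (the symmetric group) such that for all $k$: $c_k=d_{\sigma(k)}$, $s_k\le t_{\sigma(k)}$, and $\phi_k:[s_k,t_{\sigma(k)})\to\mathbb{R}$ (a pulse; no regularity conditions are imposed). - Identities: the identity permutation with empty functions. - Composition, for $(\sigma_2,[\psi_k])$ from $[(r_k,b_k)]_k$ to $[(s_k,c_k)]_k$ and $(\sigma_1,[\phi_k])$ from $[(s_k,c_k)]_k$ to $[(t_k,d_k)]_k$: $(\sigma_1,[\phi_k])\circ(\sigma_2,[\psi_k]):=(\sigma_1\circ\sigma_2,[\gamma_k])$, where $\gamma_k:[r_k,t_{(\sigma_1\circ\sigma_2)(k)})\to\mathbb{R}$ equals $\psi_k$ on $[r_k,s_{\sigma_2(k)})$ and $\phi_{\sigma_2(k)}$ on $[s_{\sigma_2(k)},t_{(\sigma_1\circ\sigma_2)(k)})$. - Tensor unit: the empty sequence. Tensor of objects: concatenation. Tensor of morphisms: $(\sigma_1,[\phi_1,\dots,\phi_m])\otimes(\sigma_2,[\psi_1,\dots,\psi_n]):=(\sigma_1\star\sigma_2,[\phi_1,\dots,\phi_m,\psi_1,\dots,\psi_n])$, with $\star:S_m\times S_n\to S_{m+n}$ the evident (block-sum) group homomorphism. - Unitors and associators are identities; the symmetry is the appropriate permutation together with empty functions.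
   Formalization: The morphisms delay_x are given only for real x ≥ 0, not for every real x: for x < 0 and a one-element X_q = [(t,c)], a morphism Shift(-x)(X_q) → X_q would need t - x ≤ t, so none exists. -}

module Defs where

open import Algebra.Core using (Op₁; Op₂)
open import Algebra.Structures using (IsCommutativeRing)
open import Data.Empty using (⊥-elim; ⊥-elim-irr)
open import Data.Fin.Base using (Fin; zero; toℕ; cast; splitAt; join; _↑ˡ_; _↑ʳ_)
open import Data.Fin.Permutation as Perm using (Permutation; _⟨$⟩ʳ_; _∘ₚ_; cast-id)
open import Data.Fin.Properties as Finₚ
  using (+↔⊎; splitAt-join; join-splitAt; splitAt-↑ˡ; splitAt-↑ʳ; toℕ-injective; toℕ-cast; toℕ-↑ˡ; toℕ-↑ʳ)
open import Data.Nat.Base as ℕ using (ℕ)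
import Data.Nat.Properties as ℕₚ
open import Data.Product.Base using (∃; _×_; _,_; proj₁; proj₂)
open import Data.Sum.Algebra using (⊎-comm)
open import Data.Sum.Base as Sum using (_⊎_; inj₁; inj₂; [_,_])
open import Data.Sum.Function.Propositional using (_⊎-↔_)
open import Data.Vec.Functional as Vector using (Vector)
open import Function.Construct.Composition using (_↔-∘_)
open import Function.Construct.Symmetry using (↔-sym)
open import Function.Definitions using (Injective)
open import Level using (Level; _⊔_; 0ℓ) renaming (suc to lsuc)
open import Relation.Binary.Bundles using (DecTotalOrder; Setoid)
open import Relation.Binary.Core using (Rel)
open import Relation.Binary.PropositionalEquality
  using (_≡_; _≢_; refl; sym; trans; cong; cong₂; subst; subst₂; module ≡-Reasoning)
open import Relation.Binary.Construct.NonStrictToStrict using (<-decidable)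
open import Relation.Binary.Definitions using (Decidable)
import Relation.Binary.Properties.DecTotalOrder as DecTotalOrderProperties
import Relation.Binary.Reasoning.Setoid as SetoidReasoning
open import Relation.Binary.Structures using (IsDecTotalOrder; IsEquivalence)
open import Relation.Nullary using (¬_; Dec; yes; no)
open import Relation.Unary using (Pred)

private
  variable
    o ℓ e : Level

------------------------------------------------------------------------
-- Real numbers

-- The standard library has no real numbers, so they enter as an
-- arbitrary Dedekind-complete totally ordered field (classically unique
-- up to isomorphism).  The order is decidable because composing pulses
-- splits a half-open interval at a point.

record RealNumbers : Set₁ where
  infix  8 -_
  infixl 7 _*_
  infixl 6 _+_
  infix  4 _≤_
  field
    ℝ   : Set
    _+_ : Op₂ ℝ
    _*_ : Op₂ ℝ
    -_  : Op₁ ℝ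
    0#  : ℝ
    1#  : ℝ
    _≤_ : Rel ℝ 0ℓ

    isCommutativeRing : IsCommutativeRing _≡_ _+_ _*_ -_ 0# 1#
    0≢1               : 0# ≢ 1#
    inverse           : ∀ x → x ≢ 0# → ∃ λ y → x * y ≡ 1#
    isDecTotalOrder   : IsDecTotalOrder _≡_ _≤_
    +-monoˡ-≤         : ∀ z {x y} → x ≤ y → x + z ≤ y + z
    *-nonNegative     : ∀ {x y} → 0# ≤ x → 0# ≤ y → 0# ≤ x * y

  UpperBound : Pred ℝ 0ℓ → Pred ℝ 0ℓ
  UpperBound P b = ∀ x → P x → x ≤ b

  field
    supremum : (P : Pred ℝ 0ℓ) → ∃ P → ∃ (UpperBound P) →
               ∃ λ s → UpperBound P s × (∀ b → UpperBound P b → s ≤ b)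

  open IsCommutativeRing isCommutativeRing public
    using (+-assoc; +-comm; +-identityˡ; +-identityʳ; -‿inverseˡ; -‿inverseʳ)

  ≤-decTotalOrder : DecTotalOrder 0ℓ 0ℓ 0ℓ
  ≤-decTotalOrder = record { isDecTotalOrder = isDecTotalOrder }

  open IsDecTotalOrder isDecTotalOrder public
    using (_≟_; _≤?_) renaming (refl to ≤-refl; reflexive to ≤-reflexive; trans to ≤-trans)

  open DecTotalOrderProperties ≤-decTotalOrder public
    using (_<_; <⇒≱; ≤⇒≯; ≮⇒≥)

  _<?_ : Decidable _<_
  _<?_ = <-decidable _≡_ _≤_ _≟_ _≤?_

  infixl 6 _-_
  _-_ : Op₂ ℝ
  x - y = x + - y

  [x+y]-y≡x : ∀ x y → (x + y) - y ≡ x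
  [x+y]-y≡x x y = trans (+-assoc x y (- y))
    (trans (cong (x +_) (-‿inverseʳ y)) (+-identityʳ x))

  [x-y]+y≡x : ∀ x y → (x - y) + y ≡ x
  [x-y]+y≡x x y = trans (+-assoc x (- y) y)
    (trans (cong (x +_) (-‿inverseˡ y)) (+-identityʳ x))

  x+y≤z⇒x≤z-y : ∀ {x y z} → x + y ≤ z → x ≤ z - y
  x+y≤z⇒x≤z-y {x} {y} {z} p = subst (_≤ z - y) ([x+y]-y≡x x y) (+-monoˡ-≤ (- y) p)

  x<y+z⇒x-z<y : ∀ {x y z} → x < y + z → x - z < y
  x<y+z⇒x-z<y {x} {y} {z} (x≤y+z , x≢y+z) =
    subst (x - z ≤_) ([x+y]-y≡x y z) (+-monoˡ-≤ (- z) x≤y+z) ,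
    λ eq → x≢y+z (trans (sym ([x-y]+y≡x x z)) (cong (_+ z) eq))

  0≤y⇒x-y≤x : ∀ x {y} → 0# ≤ y → x - y ≤ x
  0≤y⇒x-y≤x x {y} 0≤y = subst₂ _≤_ (+-identityˡ (x - y))
    (trans (+-comm y (x - y)) ([x-y]+y≡x x y)) (+-monoˡ-≤ (x - y) 0≤y)

  x-y≤x⇒0≤y : ∀ x {y} → x - y ≤ x → 0# ≤ y
  x-y≤x⇒0≤y x {y} p = subst₂ _≤_
    (trans (sym (+-assoc (x - y) y (- x)))
      (trans (cong (_- x) ([x-y]+y≡x x y)) (-‿inverseʳ x)))
    (trans (+-comm x (y - x)) ([x-y]+y≡x y x))
    (+-monoˡ-≤ (y - x) p)

------------------------------------------------------------------------
-- Symmetric monoidal categories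

record Category o ℓ e : Set (lsuc (o ⊔ ℓ ⊔ e)) where
  infix  4 _≈_
  infixr 9 _∘_
  field
    Obj : Set o
    Hom : Obj → Obj → Set ℓ
    _≈_ : ∀ {A B} → Rel (Hom A B) e
    id  : ∀ {A} → Hom A A
    _∘_ : ∀ {A B C} → Hom B C → Hom A B → Hom A C

    isEquivalence : ∀ {A B} → IsEquivalence (_≈_ {A} {B})
    ∘-resp-≈      : ∀ {A B C} {f f′ : Hom B C} {g g′ : Hom A B} →
                    f ≈ f′ → g ≈ g′ → f ∘ g ≈ f′ ∘ g′
    assoc         : ∀ {A B C D} {f : Hom A B} {g : Hom B C} {h : Hom C D} →
                    (h ∘ g) ∘ f ≈ h ∘ (g ∘ f)
    identityˡ     : ∀ {A B} {f : Hom A B} → id ∘ f ≈ f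
    identityʳ     : ∀ {A B} {f : Hom A B} → f ∘ id ≈ f

  module Equiv {A B : Obj} = IsEquivalence (isEquivalence {A} {B})

  hom-setoid : Obj → Obj → Setoid ℓ e
  hom-setoid A B = record { isEquivalence = isEquivalence {A} {B} }

  module HomReasoning {A B : Obj} = SetoidReasoning (hom-setoid A B)

  record Iso (A B : Obj) : Set (ℓ ⊔ e) where
    field
      to   : Hom A B
      from : Hom B A
      isoˡ : from ∘ to ≈ id
      isoʳ : to ∘ from ≈ id

record SymmetricMonoidalCategory o ℓ e : Set (lsuc (o ⊔ ℓ ⊔ e)) where
  field
    category : Category o ℓ e
  open Category category public
  infixr 10 _⊗₀_ _⊗₁_
  field
    unit : Obj
    _⊗₀_ : Obj → Obj → Obj
    _⊗₁_ : ∀ {A B C D} → Hom A C → Hom B D → Hom (A ⊗₀ B) (C ⊗₀ D)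

    ⊗-resp-≈ : ∀ {A B C D} {f f′ : Hom A C} {g g′ : Hom B D} →
               f ≈ f′ → g ≈ g′ → f ⊗₁ g ≈ f′ ⊗₁ g′
    ⊗-id     : ∀ {A B} → id {A} ⊗₁ id {B} ≈ id
    ⊗-∘      : ∀ {A B C A′ B′ C′}
               {f : Hom A B} {g : Hom B C} {f′ : Hom A′ B′} {g′ : Hom B′ C′} →
               (g ∘ f) ⊗₁ (g′ ∘ f′) ≈ (g ⊗₁ g′) ∘ (f ⊗₁ f′)

    associator : ∀ A B C → Iso ((A ⊗₀ B) ⊗₀ C) (A ⊗₀ (B ⊗₀ C))
    unitorˡ    : ∀ A → Iso (unit ⊗₀ A) A
    unitorʳ    : ∀ A → Iso (A ⊗₀ unit) A
    braiding   : ∀ A B → Hom (A ⊗₀ B) (B ⊗₀ A)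

  α : ∀ A B C → Hom ((A ⊗₀ B) ⊗₀ C) (A ⊗₀ (B ⊗₀ C))
  α A B C = Iso.to (associator A B C)

  λ′ : ∀ A → Hom (unit ⊗₀ A) A
  λ′ A = Iso.to (unitorˡ A)

  ρ : ∀ A → Hom (A ⊗₀ unit) A
  ρ A = Iso.to (unitorʳ A)

  field
    α-natural : ∀ {A B C A′ B′ C′} {f : Hom A A′} {g : Hom B B′} {h : Hom C C′} →
                α A′ B′ C′ ∘ ((f ⊗₁ g) ⊗₁ h) ≈ (f ⊗₁ (g ⊗₁ h)) ∘ α A B C
    λ-natural : ∀ {A A′} {f : Hom A A′} → λ′ A′ ∘ (id ⊗₁ f) ≈ f ∘ λ′ A
    ρ-natural : ∀ {A A′} {f : Hom A A′} → ρ A′ ∘ (f ⊗₁ id) ≈ f ∘ ρ A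
    braiding-natural : ∀ {A B A′ B′} {f : Hom A A′} {g : Hom B B′} →
                       braiding A′ B′ ∘ (f ⊗₁ g) ≈ (g ⊗₁ f) ∘ braiding A B

    triangle  : ∀ {A B} → (id ⊗₁ λ′ B) ∘ α A unit B ≈ ρ A ⊗₁ id
    pentagon  : ∀ {A B C D} →
                (id ⊗₁ α B C D) ∘ α A (B ⊗₀ C) D ∘ (α A B C ⊗₁ id)
                  ≈ α A B (C ⊗₀ D) ∘ α (A ⊗₀ B) C D
    symmetric : ∀ {A B} → braiding B A ∘ braiding A B ≈ id
    hexagon   : ∀ {A B C} →
                (id ⊗₁ braiding A C) ∘ α B A C ∘ (braiding A B ⊗₁ id)
                  ≈ α B C A ∘ braiding A (B ⊗₀ C) ∘ α A B C

  ⨂ : ∀ {n} → Vector Obj n → Obj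
  ⨂ = Vector.foldr _⊗₀_ unit

------------------------------------------------------------------------
-- Symmetric monoidal endofunctors and monoidal natural isomorphisms

module Endofunctors (𝒞 : SymmetricMonoidalCategory o ℓ e) where
  open SymmetricMonoidalCategory 𝒞

  record IsSymmetricMonoidalEndofunctor
    (F₀ : Obj → Obj) (F₁ : ∀ {A B} → Hom A B → Hom (F₀ A) (F₀ B))
    : Set (o ⊔ ℓ ⊔ e) where
    field
      F-resp-≈     : ∀ {A B} {f g : Hom A B} → f ≈ g → F₁ f ≈ F₁ g
      identity     : ∀ {A} → F₁ (id {A}) ≈ id
      homomorphism : ∀ {A B C} {f : Hom A B} {g : Hom B C} → F₁ (g ∘ f) ≈ F₁ g ∘ F₁ f

      ε-iso : Iso unit (F₀ unit)
      μ-iso : ∀ A B → Iso (F₀ A ⊗₀ F₀ B) (F₀ (A ⊗₀ B))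

    ε : Hom unit (F₀ unit)
    ε = Iso.to ε-iso

    μ : ∀ A B → Hom (F₀ A ⊗₀ F₀ B) (F₀ (A ⊗₀ B))
    μ A B = Iso.to (μ-iso A B)

    field
      μ-natural     : ∀ {A B A′ B′} {f : Hom A A′} {g : Hom B B′} →
                      μ A′ B′ ∘ (F₁ f ⊗₁ F₁ g) ≈ F₁ (f ⊗₁ g) ∘ μ A B
      associativity : ∀ {A B C} →
                      F₁ (α A B C) ∘ μ (A ⊗₀ B) C ∘ (μ A B ⊗₁ id)
                        ≈ μ A (B ⊗₀ C) ∘ (id ⊗₁ μ B C) ∘ α (F₀ A) (F₀ B) (F₀ C)
      unitaryˡ      : ∀ {A} → F₁ (λ′ A) ∘ μ unit A ∘ (ε ⊗₁ id) ≈ λ′ (F₀ A)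
      unitaryʳ      : ∀ {A} → F₁ (ρ A) ∘ μ A unit ∘ (id ⊗₁ ε) ≈ ρ (F₀ A)
      symmetry      : ∀ {A B} →
                      F₁ (braiding A B) ∘ μ A B ≈ μ B A ∘ braiding (F₀ A) (F₀ B)

  record SymmetricMonoidalEndofunctor : Set (o ⊔ ℓ ⊔ e) where
    field
      F₀         : Obj → Obj
      F₁         : ∀ {A B} → Hom A B → Hom (F₀ A) (F₀ B)
      isSymmetricMonoidalEndofunctor : IsSymmetricMonoidalEndofunctor F₀ F₁
    open IsSymmetricMonoidalEndofunctor isSymmetricMonoidalEndofunctor public

  record MonoidalNaturalIso (F G : SymmetricMonoidalEndofunctor) : Set (o ⊔ ℓ ⊔ e) where
    private
      module F = SymmetricMonoidalEndofunctor F
      module G = SymmetricMonoidalEndofunctor G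
    field
      component : ∀ A → Iso (F.F₀ A) (G.F₀ A)

    η : ∀ A → Hom (F.F₀ A) (G.F₀ A)
    η A = Iso.to (component A)

    field
      natural  : ∀ {A B} {f : Hom A B} → η B ∘ F.F₁ f ≈ G.F₁ f ∘ η A
      ε-compat : η unit ∘ F.ε ≈ G.ε
      μ-compat : ∀ {A B} → η (A ⊗₀ B) ∘ F.μ A B ≈ G.μ A B ∘ (η A ⊗₁ η B)

  private
    module _ where
      open Equiv renaming (refl to ≈-refl; sym to ≈-sym; trans to ≈-trans)

      idIso : ∀ {A} → Iso A A
      idIso = record { to = id ; from = id ; isoˡ = identityˡ ; isoʳ = identityˡ }

      ∘-resp-≈ˡ : ∀ {A B C} {f f′ : Hom B C} {g : Hom A B} → f ≈ f′ → f ∘ g ≈ f′ ∘ g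
      ∘-resp-≈ˡ p = ∘-resp-≈ p ≈-refl

      ∘-resp-≈ʳ : ∀ {A B C} {f : Hom B C} {g g′ : Hom A B} → g ≈ g′ → f ∘ g ≈ f ∘ g′
      ∘-resp-≈ʳ p = ∘-resp-≈ ≈-refl p

      pullˡ : ∀ {A B C D} {f : Hom C D} {g : Hom B C} {h : Hom B D} {k : Hom A B} →
              f ∘ g ≈ h → f ∘ g ∘ k ≈ h ∘ k
      pullˡ p = ≈-trans (≈-sym assoc) (∘-resp-≈ˡ p)

      extendʳ : ∀ {A B B′ C D} {f : Hom C D} {g : Hom B C} {f′ : Hom B′ D} {g′ : Hom B B′}
                {k : Hom A B} → f ∘ g ≈ f′ ∘ g′ → f ∘ g ∘ k ≈ f′ ∘ g′ ∘ k
      extendʳ p = ≈-trans (pullˡ p) assoc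

      cancelInner : ∀ {A B C D} {f : Hom C D} {g : Hom B C} {h : Hom C B} {k : Hom A C} →
                    g ∘ h ≈ id → (f ∘ g) ∘ (h ∘ k) ≈ f ∘ k
      cancelInner p = ≈-trans assoc (∘-resp-≈ʳ (≈-trans (pullˡ p) identityˡ))

      _∘ᵢ_ : ∀ {A B C} → Iso B C → Iso A B → Iso A C
      i ∘ᵢ j = record
        { to   = i.to ∘ j.to
        ; from = j.from ∘ i.from
        ; isoˡ = ≈-trans (cancelInner i.isoˡ) j.isoˡ
        ; isoʳ = ≈-trans (cancelInner j.isoʳ) i.isoʳ
        }
        where
          module i = Iso i
          module j = Iso j

      split₁ : ∀ {A B C D} {f : Hom A B} {g : Hom B C} →
               (g ∘ f) ⊗₁ id {D} ≈ (g ⊗₁ id) ∘ (f ⊗₁ id)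
      split₁ = ≈-trans (⊗-resp-≈ ≈-refl (≈-sym identityˡ)) ⊗-∘

      split₂ : ∀ {A B C D} {f : Hom A B} {g : Hom B C} →
               id {D} ⊗₁ (g ∘ f) ≈ (id ⊗₁ g) ∘ (id ⊗₁ f)
      split₂ = ≈-trans (⊗-resp-≈ (≈-sym identityˡ) ≈-refl) ⊗-∘

  idF : SymmetricMonoidalEndofunctor
  idF = record
    { F₀ = λ A → A
    ; F₁ = λ f → f
    ; isSymmetricMonoidalEndofunctor = record
      { F-resp-≈      = λ p → p
      ; identity      = Equiv.refl
      ; homomorphism  = Equiv.refl
      ; ε-iso         = idIso
      ; μ-iso         = λ _ _ → idIso
      ; μ-natural     = Equiv.trans identityˡ (Equiv.sym identityʳ)
      ; associativity = Equiv.trans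
          (∘-resp-≈ʳ (Equiv.trans identityˡ ⊗-id))
          (Equiv.trans identityʳ (Equiv.sym
            (Equiv.trans identityˡ (Equiv.trans (∘-resp-≈ˡ ⊗-id) identityˡ))))
      ; unitaryˡ      = Equiv.trans (∘-resp-≈ʳ (Equiv.trans identityˡ ⊗-id)) identityʳ
      ; unitaryʳ      = Equiv.trans (∘-resp-≈ʳ (Equiv.trans identityˡ ⊗-id)) identityʳ
      ; symmetry      = Equiv.trans identityʳ (Equiv.sym identityˡ)
      }
    }

  infixr 9 _∘F_
  _∘F_ : SymmetricMonoidalEndofunctor → SymmetricMonoidalEndofunctor →
         SymmetricMonoidalEndofunctor
  F ∘F G = record
    { F₀ = λ A → F.F₀ (G.F₀ A)
    ; F₁ = λ f → F.F₁ (G.F₁ f)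
    ; isSymmetricMonoidalEndofunctor = record
      { F-resp-≈      = λ p → F.F-resp-≈ (G.F-resp-≈ p)
      ; identity      = Equiv.trans (F.F-resp-≈ G.identity) F.identity
      ; homomorphism  = Equiv.trans (F.F-resp-≈ G.homomorphism) F.homomorphism
      ; ε-iso         = F-iso G.ε-iso ∘ᵢ F.ε-iso
      ; μ-iso         = λ A B → F-iso (G.μ-iso A B) ∘ᵢ F.μ-iso (G.F₀ A) (G.F₀ B)
      ; μ-natural     = Equiv.trans assoc (Equiv.trans (∘-resp-≈ʳ F.μ-natural)
                          (Equiv.trans (pullˡ (F-square G.μ-natural)) assoc))
      ; associativity = associativity
      ; unitaryˡ      = unitaryˡ
      ; unitaryʳ      = unitaryʳ
      ; symmetry      = Equiv.trans (pullˡ (F-square G.symmetry)) (Equiv.trans assoc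
                          (Equiv.trans (∘-resp-≈ʳ F.symmetry) (Equiv.sym assoc)))
      }
    }
    where
      module F = SymmetricMonoidalEndofunctor F
      module G = SymmetricMonoidalEndofunctor G
      open HomReasoning

      F-iso : ∀ {A B} → Iso A B → Iso (F.F₀ A) (F.F₀ B)
      F-iso i = record
        { to   = F.F₁ i.to
        ; from = F.F₁ i.from
        ; isoˡ = Equiv.trans (Equiv.sym F.homomorphism) (Equiv.trans (F.F-resp-≈ i.isoˡ) F.identity)
        ; isoʳ = Equiv.trans (Equiv.sym F.homomorphism) (Equiv.trans (F.F-resp-≈ i.isoʳ) F.identity)
        }
        where module i = Iso i

      F-square : ∀ {A B B′ C} {f : Hom B C} {g : Hom A B} {f′ : Hom B′ C} {g′ : Hom A B′} →
                 f ∘ g ≈ f′ ∘ g′ → F.F₁ f ∘ F.F₁ g ≈ F.F₁ f′ ∘ F.F₁ g′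
      F-square p = Equiv.trans (Equiv.sym F.homomorphism) (Equiv.trans (F.F-resp-≈ p) F.homomorphism)

      μ-naturalˡ : ∀ {A A′ B} {f : Hom A A′} →
                   F.μ A′ B ∘ (F.F₁ f ⊗₁ id) ≈ F.F₁ (f ⊗₁ id) ∘ F.μ A B
      μ-naturalˡ = Equiv.trans (∘-resp-≈ʳ (⊗-resp-≈ Equiv.refl (Equiv.sym F.identity))) F.μ-natural

      μ-naturalʳ : ∀ {A B B′} {g : Hom B B′} →
                   F.μ A B′ ∘ (id ⊗₁ F.F₁ g) ≈ F.F₁ (id ⊗₁ g) ∘ F.μ A B
      μ-naturalʳ = Equiv.trans (∘-resp-≈ʳ (⊗-resp-≈ (Equiv.sym F.identity) Equiv.refl)) F.μ-natural

      GF-μ : ∀ A B → Hom (F.F₀ (G.F₀ A) ⊗₀ F.F₀ (G.F₀ B)) (F.F₀ (G.F₀ (A ⊗₀ B)))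
      GF-μ A B = F.F₁ (G.μ A B) ∘ F.μ (G.F₀ A) (G.F₀ B)

      F₁-3 : ∀ {A B C D} {f : Hom A B} {g : Hom B C} {h : Hom C D} →
             F.F₁ (h ∘ g ∘ f) ≈ F.F₁ h ∘ F.F₁ g ∘ F.F₁ f
      F₁-3 = Equiv.trans F.homomorphism (∘-resp-≈ʳ F.homomorphism)

      pull₃ : ∀ {A B C D E} {f : Hom B C} {g : Hom C D} {h : Hom D E} {k : Hom A B} →
              h ∘ g ∘ f ∘ k ≈ (h ∘ g ∘ f) ∘ k
      pull₃ = Equiv.sym (Equiv.trans assoc (∘-resp-≈ʳ assoc))

      associativity : ∀ {A B C} →
        F.F₁ (G.F₁ (α A B C)) ∘ GF-μ (A ⊗₀ B) C ∘ (GF-μ A B ⊗₁ id)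
          ≈ GF-μ A (B ⊗₀ C) ∘ (id ⊗₁ GF-μ B C) ∘ α _ _ _
      associativity {A} {B} {C} = begin
        F.F₁ (G.F₁ (α A B C)) ∘ GF-μ (A ⊗₀ B) C ∘ (GF-μ A B ⊗₁ id)
          ≈⟨ ∘-resp-≈ʳ (Equiv.trans (∘-resp-≈ʳ split₁) assoc) ⟩
        F.F₁ (G.F₁ (α A B C)) ∘ F.F₁ (G.μ _ _) ∘ F.μ _ _ ∘ (F.F₁ (G.μ _ _) ⊗₁ id) ∘ (F.μ _ _ ⊗₁ id)
          ≈⟨ ∘-resp-≈ʳ (∘-resp-≈ʳ (extendʳ μ-naturalˡ)) ⟩
        F.F₁ (G.F₁ (α A B C)) ∘ F.F₁ (G.μ _ _) ∘ F.F₁ (G.μ _ _ ⊗₁ id) ∘ F.μ _ _ ∘ (F.μ _ _ ⊗₁ id)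
          ≈⟨ pull₃ ⟩
        (F.F₁ (G.F₁ (α A B C)) ∘ F.F₁ (G.μ _ _) ∘ F.F₁ (G.μ _ _ ⊗₁ id)) ∘ F.μ _ _ ∘ (F.μ _ _ ⊗₁ id)
          ≈⟨ ∘-resp-≈ˡ (Equiv.trans (Equiv.sym F₁-3) (Equiv.trans (F.F-resp-≈ G.associativity) F₁-3)) ⟩
        (F.F₁ (G.μ _ _) ∘ F.F₁ (id ⊗₁ G.μ _ _) ∘ F.F₁ (α _ _ _)) ∘ F.μ _ _ ∘ (F.μ _ _ ⊗₁ id)
          ≈⟨ Equiv.sym pull₃ ⟩
        F.F₁ (G.μ _ _) ∘ F.F₁ (id ⊗₁ G.μ _ _) ∘ F.F₁ (α _ _ _) ∘ F.μ _ _ ∘ (F.μ _ _ ⊗₁ id)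
          ≈⟨ ∘-resp-≈ʳ (∘-resp-≈ʳ F.associativity) ⟩
        F.F₁ (G.μ _ _) ∘ F.F₁ (id ⊗₁ G.μ _ _) ∘ F.μ _ _ ∘ (id ⊗₁ F.μ _ _) ∘ α _ _ _
          ≈⟨ ∘-resp-≈ʳ (extendʳ (Equiv.sym μ-naturalʳ)) ⟩
        F.F₁ (G.μ _ _) ∘ F.μ _ _ ∘ (id ⊗₁ F.F₁ (G.μ _ _)) ∘ (id ⊗₁ F.μ _ _) ∘ α _ _ _
          ≈⟨ ∘-resp-≈ʳ (∘-resp-≈ʳ (pullˡ (Equiv.sym split₂))) ⟩
        F.F₁ (G.μ _ _) ∘ F.μ _ _ ∘ (id ⊗₁ GF-μ B C) ∘ α _ _ _
          ≈⟨ Equiv.sym assoc ⟩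
        GF-μ A (B ⊗₀ C) ∘ (id ⊗₁ GF-μ B C) ∘ α _ _ _ ∎

      unitaryˡ : ∀ {A} →
        F.F₁ (G.F₁ (λ′ A)) ∘ GF-μ unit A ∘ ((F.F₁ G.ε ∘ F.ε) ⊗₁ id) ≈ λ′ _
      unitaryˡ {A} = begin
        F.F₁ (G.F₁ (λ′ A)) ∘ GF-μ unit A ∘ ((F.F₁ G.ε ∘ F.ε) ⊗₁ id)
          ≈⟨ ∘-resp-≈ʳ (Equiv.trans (∘-resp-≈ʳ split₁) assoc) ⟩
        F.F₁ (G.F₁ (λ′ A)) ∘ F.F₁ (G.μ _ _) ∘ F.μ _ _ ∘ (F.F₁ G.ε ⊗₁ id) ∘ (F.ε ⊗₁ id)
          ≈⟨ ∘-resp-≈ʳ (∘-resp-≈ʳ (extendʳ μ-naturalˡ)) ⟩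
        F.F₁ (G.F₁ (λ′ A)) ∘ F.F₁ (G.μ _ _) ∘ F.F₁ (G.ε ⊗₁ id) ∘ F.μ _ _ ∘ (F.ε ⊗₁ id)
          ≈⟨ pull₃ ⟩
        (F.F₁ (G.F₁ (λ′ A)) ∘ F.F₁ (G.μ _ _) ∘ F.F₁ (G.ε ⊗₁ id)) ∘ F.μ _ _ ∘ (F.ε ⊗₁ id)
          ≈⟨ ∘-resp-≈ˡ (Equiv.trans (Equiv.sym F₁-3) (F.F-resp-≈ G.unitaryˡ)) ⟩
        F.F₁ (λ′ _) ∘ F.μ _ _ ∘ (F.ε ⊗₁ id)
          ≈⟨ F.unitaryˡ ⟩
        λ′ _ ∎

      unitaryʳ : ∀ {A} →
        F.F₁ (G.F₁ (ρ A)) ∘ GF-μ A unit ∘ (id ⊗₁ (F.F₁ G.ε ∘ F.ε)) ≈ ρ _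
      unitaryʳ {A} = begin
        F.F₁ (G.F₁ (ρ A)) ∘ GF-μ A unit ∘ (id ⊗₁ (F.F₁ G.ε ∘ F.ε))
          ≈⟨ ∘-resp-≈ʳ (Equiv.trans (∘-resp-≈ʳ split₂) assoc) ⟩
        F.F₁ (G.F₁ (ρ A)) ∘ F.F₁ (G.μ _ _) ∘ F.μ _ _ ∘ (id ⊗₁ F.F₁ G.ε) ∘ (id ⊗₁ F.ε)
          ≈⟨ ∘-resp-≈ʳ (∘-resp-≈ʳ (extendʳ μ-naturalʳ)) ⟩
        F.F₁ (G.F₁ (ρ A)) ∘ F.F₁ (G.μ _ _) ∘ F.F₁ (id ⊗₁ G.ε) ∘ F.μ _ _ ∘ (id ⊗₁ F.ε)
          ≈⟨ pull₃ ⟩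
        (F.F₁ (G.F₁ (ρ A)) ∘ F.F₁ (G.μ _ _) ∘ F.F₁ (id ⊗₁ G.ε)) ∘ F.μ _ _ ∘ (id ⊗₁ F.ε)
          ≈⟨ ∘-resp-≈ˡ (Equiv.trans (Equiv.sym F₁-3) (F.F-resp-≈ G.unitaryʳ)) ⟩
        F.F₁ (ρ _) ∘ F.μ _ _ ∘ (id ⊗₁ F.ε)
          ≈⟨ F.unitaryʳ ⟩
        ρ _ ∎

------------------------------------------------------------------------
-- Categorical models of the annotated language

record GateSet (R : RealNumbers) (Q : Set) : Set₁ where
  open RealNumbers R
  field
    Gate         : Set
    duration     : Gate → ℝ
    duration-≥0  : ∀ G → 0# ≤ duration G
    arity        : Gate → ℕ
    qubits       : ∀ G → Vector Q (arity G)
    qubits-distinct : ∀ G → Injective _≡_ _≡_ (qubits G)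

module _ (R : RealNumbers) {Q : Set} (𝐆 : GateSet R Q)
         (𝒞 : SymmetricMonoidalCategory o ℓ e) where
  open RealNumbers R
  open GateSet 𝐆
  open SymmetricMonoidalCategory 𝒞
  open Endofunctors 𝒞

  -- delay is required for x ≥ 0 only.  In the category of signals, where a
  -- morphism never ends before it starts, Shift(-x)(X) → X does not exist
  -- for x < 0 when X is a one-element sequence (see no-negative-delay
  -- below), so delays for all real x would exclude the intended model.

  record ModelData : Set (o ⊔ ℓ) where
    field
      X      : Q → Obj
      shift₀ : ℝ → Obj → Obj
      shift₁ : ∀ x {A B} → Hom A B → Hom (shift₀ x A) (shift₀ x B)
      gate   : ∀ G → Hom (shift₀ (- duration G) (⨂ (Vector.map X (qubits G))))
                         (⨂ (Vector.map X (qubits G)))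
      delay  : ∀ x → 0# ≤ x → ∀ q → Hom (shift₀ (- x) (X q)) (X q)

  record IsCategoricalModel (M : ModelData) : Set (o ⊔ ℓ ⊔ e) where
    open ModelData M
    field
      isSymmetricMonoidalEndofunctor :
        ∀ x → IsSymmetricMonoidalEndofunctor (shift₀ x) (shift₁ x)

    Shift : ℝ → SymmetricMonoidalEndofunctor
    Shift x = record { isSymmetricMonoidalEndofunctor = isSymmetricMonoidalEndofunctor x }

    -- The remaining data make Shift a monoidal functor from the discrete
    -- category on ℝ; `along` is its action on morphisms, i.e. equalities,
    -- and functoriality and naturality in the real argument are automatic.

    along : ∀ {x y} → x ≡ y → ∀ A → Hom (shift₀ x A) (shift₀ y A)
    along {x} eq A = subst (λ y → Hom (shift₀ x A) (shift₀ y A)) eq id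

    field
      Shift-0 : MonoidalNaturalIso idF (Shift 0#)
      Shift-+ : ∀ x y → MonoidalNaturalIso (Shift x ∘F Shift y) (Shift (x + y))

    ι : ∀ A → Hom A (shift₀ 0# A)
    ι = MonoidalNaturalIso.η Shift-0

    κ : ∀ x y A → Hom (shift₀ x (shift₀ y A)) (shift₀ (x + y) A)
    κ x y = MonoidalNaturalIso.η (Shift-+ x y)

    field
      Shift-assoc : ∀ x y z A →
        along (+-assoc x y z) A ∘ κ (x + y) z A ∘ κ x y (shift₀ z A)
          ≈ κ x (y + z) A ∘ shift₁ x (κ y z A)
      Shift-identityˡ : ∀ x A →
        along (+-identityˡ x) A ∘ κ 0# x A ∘ ι (shift₀ x A) ≈ id
      Shift-identityʳ : ∀ x A →
        along (+-identityʳ x) A ∘ κ x 0# A ∘ shift₁ x (ι A) ≈ id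

------------------------------------------------------------------------
-- The category of signals

module Signals (R : RealNumbers) (C : Set) where
  open RealNumbers R

  record Signal : Set where
    constructor signal
    field
      {length} : ℕ
      entry    : Vector (ℝ × C) length

    start : Fin length → ℝ
    start k = proj₁ (entry k)

    channel : Fin length → C
    channel k = proj₂ (entry k)

  open Signal

  -- A Permutation m n is a bijection Fin m ↔ Fin n, so it exists only for
  -- m ≡ n.  The irrelevant bounds make pulse k a function of the points of
  -- [ start X k , start Y (σ k) ) alone.

  record Pulses (X Y : Signal) : Set where
    field
      σ         : Permutation (length X) (length Y)
      channel-≡ : ∀ k → channel X k ≡ channel Y (σ ⟨$⟩ʳ k)
      start-≤   : ∀ k → start X k ≤ start Y (σ ⟨$⟩ʳ k)
      pulse     : ∀ k u → .(start X k ≤ u) → .(u < start Y (σ ⟨$⟩ʳ k)) → ℝ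

    target : Fin (length X) → Fin (length Y)
    target = σ ⟨$⟩ʳ_

  open Pulses

  infix 4 _≋_
  record _≋_ {X Y : Signal} (f g : Pulses X Y) : Set where
    constructor mk≋
    field
      σ-≡     : ∀ k → target f k ≡ target g k
      pulse-≡ : ∀ k u .p .q .q′ → pulse f k u p q ≡ pulse g k u p q′

  open _≋_

  idₛ : ∀ {X} → Pulses X X
  idₛ {X} = record
    { σ         = Perm.id
    ; channel-≡ = λ _ → refl
    ; start-≤   = λ _ → ≤-refl
    ; pulse     = λ k u s≤u u<s → ⊥-elim-irr (<⇒≱ u<s s≤u)
    }

  splice : ∀ {u s} → Dec (u < s) → (.(u < s) → ℝ) → (.(s ≤ u) → ℝ) → ℝ
  splice (yes u<s) ψ φ = ψ u<s
  splice (no  u≮s) ψ φ = φ (≮⇒≥ u≮s)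

  infixr 9 _∘ₛ_
  _∘ₛ_ : ∀ {X Y Z} → Pulses Y Z → Pulses X Y → Pulses X Z
  _∘ₛ_ {X} {Y} {Z} f g = record
    { σ         = σ g ∘ₚ σ f
    ; channel-≡ = λ k → trans (channel-≡ g k) (channel-≡ f (target g k))
    ; start-≤   = λ k → ≤-trans (start-≤ g k) (start-≤ f (target g k))
    ; pulse     = λ k u r≤u u<t →
        splice (u <? start Y (target g k))
          (λ u<s → pulse g k u r≤u u<s)
          (λ s≤u → pulse f (target g k) u s≤u u<t)
    }

  unitₛ : Signal
  unitₛ = signal Vector.[]

  infixr 10 _⊗ₛ_
  _⊗ₛ_ : Signal → Signal → Signal
  X ⊗ₛ Y = signal (entry X Vector.++ entry Y)

  -- Positions of a concatenation are Fin (m + n), identified with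
  -- Fin m ⊎ Fin n by splitAt and join.

  entry⊎ : ∀ X Y → Fin (length X) ⊎ Fin (length Y) → ℝ × C
  entry⊎ X Y = [ entry X , entry Y ]

  module _ {X Y X′ Y′ : Signal} (f : Pulses X X′) (g : Pulses Y Y′) where

    target⊎ : Fin (length X) ⊎ Fin (length Y) → Fin (length X′) ⊎ Fin (length Y′)
    target⊎ = Sum.map (target f) (target g)

    channel⊎-≡ : ∀ s → proj₂ (entry⊎ X Y s) ≡ proj₂ (entry⊎ X′ Y′ (target⊎ s))
    channel⊎-≡ (inj₁ i) = channel-≡ f i
    channel⊎-≡ (inj₂ j) = channel-≡ g j

    start⊎-≤ : ∀ s → proj₁ (entry⊎ X Y s) ≤ proj₁ (entry⊎ X′ Y′ (target⊎ s))
    start⊎-≤ (inj₁ i) = start-≤ f i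
    start⊎-≤ (inj₂ j) = start-≤ g j

    pulse⊎ : ∀ s u → .(proj₁ (entry⊎ X Y s) ≤ u) →
             .(u < proj₁ (entry⊎ X′ Y′ (target⊎ s))) → ℝ
    pulse⊎ (inj₁ i) = pulse f i
    pulse⊎ (inj₂ j) = pulse g j

    entry-join : ∀ s → entry⊎ X′ Y′ s ≡ entry (X′ ⊗ₛ Y′) (join _ _ s)
    entry-join s = cong (entry⊎ X′ Y′) (sym (splitAt-join _ _ s))

    infixr 10 _⊗ₚ_
    _⊗ₚ_ : Pulses (X ⊗ₛ Y) (X′ ⊗ₛ Y′)
    _⊗ₚ_ = record
      { σ         = ↔-sym +↔⊎ ↔-∘ ((σ f ⊎-↔ σ g) ↔-∘ +↔⊎)
      ; channel-≡ = λ k → let s = splitAt (length X) k in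
          trans (channel⊎-≡ s) (cong proj₂ (entry-join (target⊎ s)))
      ; start-≤   = λ k → let s = splitAt (length X) k in
          ≤-trans (start⊎-≤ s) (≤-reflexive (cong proj₁ (entry-join (target⊎ s))))
      ; pulse     = λ k u p q → let s = splitAt (length X) k in
          pulse⊎ s u p (subst (λ e → u < proj₁ e) (sym (entry-join (target⊎ s))) q)
      }

  -- A permutation matching equal entries, together with empty pulses.

  relabel : ∀ {X Y} (σ : Permutation (length X) (length Y)) →
            (∀ k → entry X k ≡ entry Y (σ ⟨$⟩ʳ k)) → Pulses X Y
  relabel {X} {Y} σ eq = record
    { σ         = σ
    ; channel-≡ = λ k → cong proj₂ (eq k)
    ; start-≤   = λ k → ≤-reflexive (cong proj₁ (eq k))
    ; pulse     = λ k u p q →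
        ⊥-elim-irr (<⇒≱ (subst (λ e → u < proj₁ e) (sym (eq k)) q) p)
    }

  ----------------------------------------------------------------------
  -- Laws

  ≋-refl : ∀ {X Y} {f : Pulses X Y} → f ≋ f
  ≋-refl = mk≋ (λ _ → refl) (λ _ _ _ _ _ → refl)

  pulse-cong : ∀ {X Y} (f : Pulses X Y) {k k′} → k ≡ k′ →
               ∀ u .p .q .p′ .q′ → pulse f k u p q ≡ pulse f k′ u p′ q′
  pulse-cong f refl u p q p′ q′ = refl

  ≋-isEquivalence : ∀ {X Y} → IsEquivalence (_≋_ {X} {Y})
  ≋-isEquivalence {X} {Y} = record
    { refl  = ≋-refl
    ; sym   = λ f≋g → mk≋ (λ k → sym (σ-≡ f≋g k))
                          (λ k u p q q′ → sym (pulse-≡ f≋g k u p q′ q))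
    ; trans = λ {_} {g} f≋g g≋h → mk≋
        (λ k → trans (σ-≡ f≋g k) (σ-≡ g≋h k))
        (λ k u p q q′ → trans
          (pulse-≡ f≋g k u p q (subst (λ l → u < start Y l) (σ-≡ f≋g k) q))
          (pulse-≡ g≋h k u p _ q′))
    }

  splice-cong : ∀ {u s s′} (d : Dec (u < s)) (d′ : Dec (u < s′)) → s ≡ s′ →
                {ψ : .(u < s) → ℝ} {ψ′ : .(u < s′) → ℝ}
                {φ : .(s ≤ u) → ℝ} {φ′ : .(s′ ≤ u) → ℝ} →
                (∀ .p .p′ → ψ p ≡ ψ′ p′) → (∀ .p .p′ → φ p ≡ φ′ p′) →
                splice d ψ φ ≡ splice d′ ψ′ φ′
  splice-cong (yes p) (yes p′) eq ψ≡ φ≡ = ψ≡ p p′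
  splice-cong (yes p) (no p′)  eq ψ≡ φ≡ = ⊥-elim (p′ (subst (_ <_) eq p))
  splice-cong (no p)  (yes p′) eq ψ≡ φ≡ = ⊥-elim (p (subst (_ <_) (sym eq) p′))
  splice-cong (no p)  (no p′)  eq ψ≡ φ≡ = φ≡ (≮⇒≥ p) (≮⇒≥ p′)

  splice-assoc : ∀ {u s t} (d : Dec (u < s)) (d′ : Dec (u < t)) → s ≤ t →
                 {χ : .(u < s) → ℝ} {ψ : .(s ≤ u) → .(u < t) → ℝ} {φ : .(t ≤ u) → ℝ} →
                 splice d χ (λ p → splice d′ (λ q → ψ p q) φ)
                   ≡ splice d′ (λ q → splice d χ (λ p → ψ p q)) φ
  splice-assoc (yes _) (yes _) s≤t = refl
  splice-assoc (yes p) (no q)  s≤t = ⊥-elim (<⇒≱ p (≤-trans s≤t (≮⇒≥ q)))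
  splice-assoc (no _)  (yes _) s≤t = refl
  splice-assoc (no _)  (no _)  s≤t = refl

  splice-yes : ∀ {u s} (d : Dec (u < s)) → .(u < s) →
               {ψ : .(u < s) → ℝ} {φ : .(s ≤ u) → ℝ} {x : ℝ} →
               (∀ .p → ψ p ≡ x) → splice d ψ φ ≡ x
  splice-yes (yes p) _ ψ≡ = ψ≡ p
  splice-yes (no p)  q ψ≡ = ⊥-elim-irr (p q)

  splice-no : ∀ {u s} (d : Dec (u < s)) → .(s ≤ u) →
              {ψ : .(u < s) → ℝ} {φ : .(s ≤ u) → ℝ} {x : ℝ} →
              (∀ .p → φ p ≡ x) → splice d ψ φ ≡ x
  splice-no (yes p) q φ≡ = ⊥-elim-irr (<⇒≱ p q)
  splice-no (no p)  _ φ≡ = φ≡ (≮⇒≥ p)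

  -- Pulses at two positions with the same interval and the same values

  record Agree {X Y X′ Y′} (f : Pulses X Y) (k : Fin (length X))
               (g : Pulses X′ Y′) (l : Fin (length X′)) : Set where
    field
      start-eq : start X k ≡ start X′ l
      end-eq   : start Y (target f k) ≡ start Y′ (target g l)
      pulse-eq : ∀ u .p .q .p′ .q′ → pulse f k u p q ≡ pulse g l u p′ q′

  open Agree

  agree-sym : ∀ {X Y X′ Y′} {f : Pulses X Y} {k} {g : Pulses X′ Y′} {l} →
              Agree f k g l → Agree g l f k
  agree-sym a = record
    { start-eq = sym (start-eq a)
    ; end-eq   = sym (end-eq a)
    ; pulse-eq = λ u p q p′ q′ → sym (pulse-eq a u p′ q′ p q)
    }

  agree-trans : ∀ {X Y X′ Y′ X″ Y″} {f : Pulses X Y} {k} {g : Pulses X′ Y′} {l}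
                {h : Pulses X″ Y″} {m} → Agree f k g l → Agree g l h m → Agree f k h m
  agree-trans a b = record
    { start-eq = trans (start-eq a) (start-eq b)
    ; end-eq   = trans (end-eq a) (end-eq b)
    ; pulse-eq = λ u p q p′ q′ → trans
        (pulse-eq a u p q (subst (_≤ u) (start-eq a) p) (subst (u <_) (end-eq a) q))
        (pulse-eq b u (subst (_≤ u) (start-eq a) p) (subst (u <_) (end-eq a) q) p′ q′)
    }

  agree-cong : ∀ {X Y} (f : Pulses X Y) {k l} → k ≡ l → Agree f k f l
  agree-cong f refl = record
    { start-eq = refl ; end-eq = refl ; pulse-eq = λ _ _ _ _ _ → refl }

  agree-≋ : ∀ {X Y} {f g : Pulses X Y} → (∀ k → target f k ≡ target g k) →
            (∀ k → Agree f k g k) → f ≋ g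
  agree-≋ eq a = mk≋ eq λ k u p q q′ → pulse-eq (a k) u p q p q′

  ≋-agree : ∀ {X Y} {f g : Pulses X Y} → f ≋ g → ∀ k → Agree f k g k
  ≋-agree {Y = Y} f≋g k = record
    { start-eq = refl
    ; end-eq   = cong (start Y) (σ-≡ f≋g k)
    ; pulse-eq = λ u p q p′ q′ → pulse-≡ f≋g k u p q q′
    }

  agree-∘ : ∀ {X Y Z X′ Y′ Z′} {f : Pulses Y Z} {g : Pulses X Y}
            {f′ : Pulses Y′ Z′} {g′ : Pulses X′ Y′} {k l} →
            Agree f (target g k) f′ (target g′ l) → Agree g k g′ l →
            Agree (f ∘ₛ g) k (f′ ∘ₛ g′) l
  agree-∘ a b = record
    { start-eq = start-eq b
    ; end-eq   = end-eq a
    ; pulse-eq = λ u p q p′ q′ → splice-cong (u <? _) (u <? _) (end-eq b)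
        (λ r r′ → pulse-eq b u p r p′ r′)
        (λ r r′ → pulse-eq a u r q r′ q′)
    }

  -- Morphisms all of whose pulses are empty

  Instant : ∀ {X Y} → Pulses X Y → Set
  Instant {X} {Y} f = ∀ k → start X k ≡ start Y (target f k)

  instant-≋ : ∀ {X Y} {f g : Pulses X Y} → Instant f →
              (∀ k → target f k ≡ target g k) → f ≋ g
  instant-≋ {X} {Y} i eq = mk≋ eq λ k u p q q′ →
    ⊥-elim-irr (<⇒≱ (subst (u <_) (sym (i k)) q) p)

  instant-id : ∀ {X} → Instant (idₛ {X})
  instant-id k = refl

  instant-relabel : ∀ {X Y} (σ : Permutation (length X) (length Y)) eq →
                    Instant (relabel {X} {Y} σ eq)
  instant-relabel σ eq k = cong proj₁ (eq k)

  instant-∘ : ∀ {X Y Z} (f : Pulses Y Z) (g : Pulses X Y) →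
              Instant f → Instant g → Instant (f ∘ₛ g)
  instant-∘ f g i j k = trans (j k) (i (target g k))

  instant-⊗ : ∀ {X Y X′ Y′} (f : Pulses X X′) (g : Pulses Y Y′) →
              Instant f → Instant g → Instant (f ⊗ₚ g)
  instant-⊗ {X} {Y} {X′} {Y′} f g i j k =
    trans (lemma (splitAt (length X) k)) (cong proj₁ (entry-join f g (target⊎ f g (splitAt (length X) k))))
    where
      lemma : ∀ s → proj₁ (entry⊎ X Y s) ≡ proj₁ (entry⊎ X′ Y′ (target⊎ f g s))
      lemma (inj₁ a) = i a
      lemma (inj₂ b) = j b

  agree-∘ʳ : ∀ {X Y Z} (f : Pulses Y Z) (r : Pulses X Y) → Instant r →
             ∀ k → Agree (f ∘ₛ r) k f (target r k)
  agree-∘ʳ f r i k = record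
    { start-eq = i k
    ; end-eq   = refl
    ; pulse-eq = λ u p q p′ q′ → splice-no (u <? _) p′ λ _ → refl
    }

  agree-∘ˡ : ∀ {X Y Z} (r : Pulses Y Z) (f : Pulses X Y) → Instant r →
             ∀ k → Agree (r ∘ₛ f) k f k
  agree-∘ˡ r f i k = record
    { start-eq = refl
    ; end-eq   = sym (i (target f k))
    ; pulse-eq = λ u p q p′ q′ → splice-yes (u <? _) q′ λ _ → refl
    }

  instant-natural : ∀ {X Y X′ Y′} (f : Pulses X Y) (g : Pulses X′ Y′)
    (r : Pulses X X′) (r′ : Pulses Y Y′) → Instant r → Instant r′ →
    (∀ k → target g (target r k) ≡ target r′ (target f k)) →
    (∀ k → Agree g (target r k) f k) → r′ ∘ₛ f ≋ g ∘ₛ r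
  instant-natural f g r r′ i i′ eq a = agree-≋ (λ k → sym (eq k)) λ k →
    agree-trans (agree-∘ˡ r′ f i′ k) (agree-sym (agree-trans (agree-∘ʳ g r i k) (a k)))

  ∘-resp : ∀ {X Y Z} {f f′ : Pulses Y Z} {g g′ : Pulses X Y} →
           f ≋ f′ → g ≋ g′ → f ∘ₛ g ≋ f′ ∘ₛ g′
  ∘-resp {f = f} {f′} {g} {g′} f≋ g≋ = agree-≋
    (λ k → trans (σ-≡ f≋ _) (cong (target f′) (σ-≡ g≋ k)))
    (λ k → agree-∘ (agree-trans (≋-agree f≋ _) (agree-cong f′ (σ-≡ g≋ k))) (≋-agree g≋ k))

  Signalsᶜ : Category 0ℓ 0ℓ 0ℓ
  Signalsᶜ = record
    { Obj           = Signal
    ; Hom           = Pulses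
    ; _≈_           = _≋_
    ; id            = idₛ
    ; _∘_           = _∘ₛ_
    ; isEquivalence = ≋-isEquivalence
    ; ∘-resp-≈      = ∘-resp
    ; assoc         = λ {_} {_} {_} {_} {f} {g} {h} → mk≋ (λ _ → refl) λ k u p q q′ →
        splice-assoc (u <? _) (u <? _) (start-≤ g (target f k))
    ; identityˡ     = λ {X} {Y} {f} → agree-≋ (λ _ → refl) (agree-∘ˡ idₛ f (instant-id {Y}))
    ; identityʳ     = λ {X} {Y} {f} → agree-≋ (λ _ → refl) (agree-∘ʳ f idₛ (instant-id {X}))
    }

  braidₛ : ∀ X Y → Pulses (X ⊗ₛ Y) (Y ⊗ₛ X)
  braidₛ X Y = relabel (↔-sym (+↔⊎ {length Y} {length X}) ↔-∘ (⊎-comm _ _ ↔-∘ +↔⊎)) λ k → let s = splitAt (length X) k in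
    trans (swap-entry s) (cong (entry⊎ Y X) (sym (splitAt-join _ _ (Sum.swap s))))
    where
      swap-entry : ∀ s → entry⊎ X Y s ≡ entry⊎ Y X (Sum.swap s)
      swap-entry (inj₁ i) = refl
      swap-entry (inj₂ j) = refl

  ++-cases : ∀ {m n} (P : Fin (m ℕ.+ n) → Set) →
             (∀ i → P (i ↑ˡ n)) → (∀ j → P (m ↑ʳ j)) → ∀ k → P k
  ++-cases {m} {n} P l r k = subst P (join-splitAt m n k) (go (splitAt m k))
    where
      go : ∀ s → P (join m n s)
      go (inj₁ i) = l i
      go (inj₂ j) = r j

  module _ (X Y : Signal) where
    entry-↑ˡ : ∀ i → entry (X ⊗ₛ Y) (i ↑ˡ length Y) ≡ entry X i
    entry-↑ˡ i = cong (entry⊎ X Y) (splitAt-↑ˡ (length X) i (length Y))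

    entry-↑ʳ : ∀ j → entry (X ⊗ₛ Y) (length X ↑ʳ j) ≡ entry Y j
    entry-↑ʳ j = cong (entry⊎ X Y) (splitAt-↑ʳ (length X) (length Y) j)

    braid-↑ˡ : ∀ i → target (braidₛ X Y) (i ↑ˡ length Y) ≡ length Y ↑ʳ i
    braid-↑ˡ i = cong (λ s → join _ _ (Sum.swap s)) (splitAt-↑ˡ (length X) i (length Y))

    braid-↑ʳ : ∀ j → target (braidₛ X Y) (length X ↑ʳ j) ≡ j ↑ˡ length X
    braid-↑ʳ j = cong (λ s → join _ _ (Sum.swap s)) (splitAt-↑ʳ (length X) (length Y) j)

  module _ {X Y X′ Y′ : Signal} (f : Pulses X X′) (g : Pulses Y Y′) where
    target-↑ˡ : ∀ i → target (f ⊗ₚ g) (i ↑ˡ length Y) ≡ target f i ↑ˡ length Y′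
    target-↑ˡ i = cong (λ s → join _ _ (target⊎ f g s)) (splitAt-↑ˡ (length X) i (length Y))

    target-↑ʳ : ∀ j → target (f ⊗ₚ g) (length X ↑ʳ j) ≡ length X′ ↑ʳ target g j
    target-↑ʳ j = cong (λ s → join _ _ (target⊎ f g s)) (splitAt-↑ʳ (length X) (length Y) j)

    agree⊎ : ∀ k s → splitAt (length X) k ≡ s →
             (∀ {A B} (h : Pulses A B) l →
               proj₁ (entry⊎ X Y s) ≡ start A l → proj₁ (entry⊎ X′ Y′ (target⊎ f g s)) ≡ start B (target h l) →
               (∀ u .p .q .p′ .q′ → pulse⊎ f g s u p q ≡ pulse h l u p′ q′) →
               Agree (f ⊗ₚ g) k h l)
    agree⊎ k s refl h l start-eq end-eq pulse-eq = record
      { start-eq = start-eq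
      ; end-eq   = trans (sym (cong proj₁ (entry-join f g (target⊎ f g s)))) end-eq
      ; pulse-eq = λ u p q p′ q′ → pulse-eq u p
          (subst (λ e → u < proj₁ e) (sym (entry-join f g (target⊎ f g s))) q) p′ q′
      }

    agree-↑ˡ : ∀ i → Agree (f ⊗ₚ g) (i ↑ˡ length Y) f i
    agree-↑ˡ i = agree⊎ _ (inj₁ i) (splitAt-↑ˡ (length X) i (length Y)) f i refl refl
      (λ _ _ _ _ _ → refl)

    agree-↑ʳ : ∀ j → Agree (f ⊗ₚ g) (length X ↑ʳ j) g j
    agree-↑ʳ j = agree⊎ _ (inj₂ j) (splitAt-↑ʳ (length X) (length Y) j) g j refl refl
      (λ _ _ _ _ _ → refl)

  assocₛ : ∀ X Y Z → Pulses ((X ⊗ₛ Y) ⊗ₛ Z) (X ⊗ₛ (Y ⊗ₛ Z))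
  assocₛ⁻¹ : ∀ X Y Z → Pulses (X ⊗ₛ (Y ⊗ₛ Z)) ((X ⊗ₛ Y) ⊗ₛ Z)

  module _ {m n o : ℕ} where
    cast-assoc₁ : ∀ (i : Fin m) →
                  cast (ℕₚ.+-assoc m n o) ((i ↑ˡ n) ↑ˡ o) ≡ i ↑ˡ (n ℕ.+ o)
    cast-assoc₁ i = toℕ-injective (trans (toℕ-cast _ ((i ↑ˡ n) ↑ˡ o))
      (trans (toℕ-↑ˡ (i ↑ˡ n) o) (trans (toℕ-↑ˡ i n) (sym (toℕ-↑ˡ i (n ℕ.+ o))))))

    cast-assoc₂ : ∀ (j : Fin n) →
                  cast (ℕₚ.+-assoc m n o) ((m ↑ʳ j) ↑ˡ o) ≡ m ↑ʳ (j ↑ˡ o)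
    cast-assoc₂ j = toℕ-injective (trans (toℕ-cast _ ((m ↑ʳ j) ↑ˡ o))
      (trans (toℕ-↑ˡ (m ↑ʳ j) o) (trans (toℕ-↑ʳ m j)
        (sym (trans (toℕ-↑ʳ m (j ↑ˡ o)) (cong (m ℕ.+_) (toℕ-↑ˡ j o)))))))

    cast-assoc₃ : ∀ (k : Fin o) →
                  cast (ℕₚ.+-assoc m n o) ((m ℕ.+ n) ↑ʳ k) ≡ m ↑ʳ (n ↑ʳ k)
    cast-assoc₃ k = toℕ-injective (trans (toℕ-cast _ ((m ℕ.+ n) ↑ʳ k))
      (trans (toℕ-↑ʳ (m ℕ.+ n) k) (trans (ℕₚ.+-assoc m n (toℕ k))
        (sym (trans (toℕ-↑ʳ m (n ↑ʳ k)) (cong (m ℕ.+_) (toℕ-↑ʳ n k)))))))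

  assoc-entry : ∀ X Y Z k → entry ((X ⊗ₛ Y) ⊗ₛ Z) k
                  ≡ entry (X ⊗ₛ (Y ⊗ₛ Z)) (cast (ℕₚ.+-assoc (length X) (length Y) (length Z)) k)
  assoc-entry X Y Z = ++-cases _ (++-cases _
    (λ i → trans (trans (entry-↑ˡ (X ⊗ₛ Y) Z _) (entry-↑ˡ X Y i))
      (sym (trans (cong E (cast-assoc₁ i)) (entry-↑ˡ X (Y ⊗ₛ Z) i))))
    (λ j → trans (trans (entry-↑ˡ (X ⊗ₛ Y) Z _) (entry-↑ʳ X Y j))
      (sym (trans (cong E (cast-assoc₂ j)) (trans (entry-↑ʳ X (Y ⊗ₛ Z) _) (entry-↑ˡ Y Z j))))))
    (λ k → trans (entry-↑ʳ (X ⊗ₛ Y) Z k)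
      (sym (trans (cong E (cast-assoc₃ {length X} k)) (trans (entry-↑ʳ X (Y ⊗ₛ Z) _) (entry-↑ʳ Y Z k)))))
    where E = entry (X ⊗ₛ (Y ⊗ₛ Z))

  cast-entry : ∀ {X Y} .(eq : length X ≡ length Y) .(eq′ : length Y ≡ length X) →
               (∀ k → entry X k ≡ entry Y (cast eq k)) → ∀ k → entry Y k ≡ entry X (cast eq′ k)
  cast-entry {X} {Y} eq eq′ h k =
    sym (trans (h (cast eq′ k)) (cong (entry Y) (Finₚ.cast-involutive eq eq′ k)))

  assoc⁻¹-entry : ∀ X Y Z k → entry (X ⊗ₛ (Y ⊗ₛ Z)) k
                    ≡ entry ((X ⊗ₛ Y) ⊗ₛ Z) (cast (sym (ℕₚ.+-assoc (length X) (length Y) (length Z))) k)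
  assoc⁻¹-entry X Y Z = cast-entry {(X ⊗ₛ Y) ⊗ₛ Z} {X ⊗ₛ (Y ⊗ₛ Z)}
    (ℕₚ.+-assoc (length X) (length Y) (length Z)) _ (assoc-entry X Y Z)

  -- The unitors and associators preserve positions and entries.  They are
  -- casts only because m + n + 0 and the like are not definitionally equal.

  assocₛ X Y Z = relabel (cast-id (ℕₚ.+-assoc (length X) (length Y) (length Z))) (assoc-entry X Y Z)

  assocₛ⁻¹ X Y Z = relabel (cast-id (sym (ℕₚ.+-assoc (length X) (length Y) (length Z))))
    (assoc⁻¹-entry X Y Z)

  unitˡₛ : ∀ X → Pulses (unitₛ ⊗ₛ X) X
  unitˡₛ X = relabel Perm.id (λ _ → refl)

  unitˡₛ⁻¹ : ∀ X → Pulses X (unitₛ ⊗ₛ X)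
  unitˡₛ⁻¹ X = relabel Perm.id (λ _ → refl)

  unitʳ-entry : ∀ X k → entry (X ⊗ₛ unitₛ) k ≡ entry X (cast (ℕₚ.+-identityʳ (length X)) k)
  unitʳ-entry X = ++-cases _
    (λ i → trans (entry-↑ˡ X unitₛ i) (cong (entry X) (sym (toℕ-injective
      (trans (toℕ-cast _ (i ↑ˡ 0)) (toℕ-↑ˡ i 0))))))
    λ ()

  unitʳ⁻¹-entry : ∀ X k → entry X k ≡ entry (X ⊗ₛ unitₛ) (cast (sym (ℕₚ.+-identityʳ (length X))) k)
  unitʳ⁻¹-entry X = cast-entry {X ⊗ₛ unitₛ} {X} (ℕₚ.+-identityʳ (length X)) _ (unitʳ-entry X)

  unitʳₛ : ∀ X → Pulses (X ⊗ₛ unitₛ) X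
  unitʳₛ X = relabel (cast-id (ℕₚ.+-identityʳ (length X))) (unitʳ-entry X)

  unitʳₛ⁻¹ : ∀ X → Pulses X (X ⊗ₛ unitₛ)
  unitʳₛ⁻¹ X = relabel (cast-id (sym (ℕₚ.+-identityʳ (length X))))
    (unitʳ⁻¹-entry X)

  -- Morphisms whose permutation preserves positions

  Stationary : ∀ {X Y} → Pulses X Y → Set
  Stationary f = ∀ k → toℕ (target f k) ≡ toℕ k

  stationary-≋ : ∀ {X Y} {f g : Pulses X Y} → Instant f →
                 Stationary f → Stationary g → f ≋ g
  stationary-≋ i sf sg = instant-≋ i (λ k → toℕ-injective (trans (sf k) (sym (sg k))))

  stationary-∘ : ∀ {X Y Z} (f : Pulses Y Z) (g : Pulses X Y) →
                 Stationary f → Stationary g → Stationary (f ∘ₛ g)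
  stationary-∘ f g sf sg k = trans (sf (target g k)) (sg k)

  stationary-⊗ : ∀ {X Y X′ Y′} (f : Pulses X X′) (g : Pulses Y Y′) →
                 Stationary f → Stationary g → Stationary (f ⊗ₚ g)
  stationary-⊗ {X} {Y} {X′} {Y′} f g sf sg = ++-cases _
    (λ i → trans (cong toℕ (target-↑ˡ f g i)) (trans (toℕ-↑ˡ (target f i) _)
      (trans (sf i) (sym (toℕ-↑ˡ i _)))))
    (λ j → trans (cong toℕ (target-↑ʳ f g j)) (trans (toℕ-↑ʳ (length X′) (target g j))
      (trans (cong₂ ℕ._+_ (sym (Perm.↔⇒≡ (σ f))) (sg j)) (sym (toℕ-↑ʳ (length X) j)))))

  stationary-cast : ∀ {X Y} .(eq : length X ≡ length Y) h →
                    Stationary (relabel {X} {Y} (cast-id eq) h)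
  stationary-cast eq h k = toℕ-cast eq k

  instant-assoc : ∀ X Y Z → Instant (assocₛ X Y Z)
  instant-assoc X Y Z k = cong proj₁ (assoc-entry X Y Z k)

  instant-unitʳ : ∀ X → Instant (unitʳₛ X)
  instant-unitʳ X k = cong proj₁ (unitʳ-entry X k)

  instant-assoc⁻¹ : ∀ X Y Z → Instant (assocₛ⁻¹ X Y Z)
  instant-assoc⁻¹ X Y Z k = cong proj₁ (assoc⁻¹-entry X Y Z k)

  instant-unitʳ⁻¹ : ∀ X → Instant (unitʳₛ⁻¹ X)
  instant-unitʳ⁻¹ X k = cong proj₁ (unitʳ⁻¹-entry X k)

  module _ {X Y X′ Y′} {f f′ : Pulses X X′} {g g′ : Pulses Y Y′} where
    ⊗-resp : f ≋ f′ → g ≋ g′ → f ⊗ₚ g ≋ f′ ⊗ₚ g′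
    ⊗-resp f≋ g≋ = agree-≋
      (++-cases _
        (λ i → trans (target-↑ˡ f g i) (trans (cong (_↑ˡ _) (σ-≡ f≋ i)) (sym (target-↑ˡ f′ g′ i))))
        (λ j → trans (target-↑ʳ f g j) (trans (cong (_ ↑ʳ_) (σ-≡ g≋ j)) (sym (target-↑ʳ f′ g′ j)))))
      (++-cases _
        (λ i → agree-trans (agree-↑ˡ f g i) (agree-trans (≋-agree f≋ i) (agree-sym (agree-↑ˡ f′ g′ i))))
        (λ j → agree-trans (agree-↑ʳ f g j) (agree-trans (≋-agree g≋ j) (agree-sym (agree-↑ʳ f′ g′ j)))))

  module _ {X Y Z X′ Y′ Z′} {f : Pulses X Y} {g : Pulses Y Z}
           {f′ : Pulses X′ Y′} {g′ : Pulses Y′ Z′} where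
    ⊗-∘ₛ : (g ∘ₛ f) ⊗ₚ (g′ ∘ₛ f′) ≋ (g ⊗ₚ g′) ∘ₛ (f ⊗ₚ f′)
    ⊗-∘ₛ = agree-≋
      (++-cases _
        (λ i → trans (target-↑ˡ (g ∘ₛ f) (g′ ∘ₛ f′) i)
          (sym (trans (cong (target (g ⊗ₚ g′)) (target-↑ˡ f f′ i)) (target-↑ˡ g g′ _))))
        (λ j → trans (target-↑ʳ (g ∘ₛ f) (g′ ∘ₛ f′) j)
          (sym (trans (cong (target (g ⊗ₚ g′)) (target-↑ʳ f f′ j)) (target-↑ʳ g g′ _)))))
      (++-cases _
        (λ i → agree-trans (agree-↑ˡ (g ∘ₛ f) (g′ ∘ₛ f′) i) (agree-sym (agree-∘
          (agree-trans (agree-cong (g ⊗ₚ g′) (target-↑ˡ f f′ i)) (agree-↑ˡ g g′ _))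
          (agree-↑ˡ f f′ i))))
        (λ j → agree-trans (agree-↑ʳ (g ∘ₛ f) (g′ ∘ₛ f′) j) (agree-sym (agree-∘
          (agree-trans (agree-cong (g ⊗ₚ g′) (target-↑ʳ f f′ j)) (agree-↑ʳ g g′ _))
          (agree-↑ʳ f f′ j)))))

  module _ {X Y Z X′ Y′ Z′} (f : Pulses X X′) (g : Pulses Y Y′) (h : Pulses Z Z′) where
    private
      A    = assocₛ X Y Z
      A′   = assocₛ X′ Y′ Z′
      fg-h = (f ⊗ₚ g) ⊗ₚ h
      f-gh = f ⊗ₚ (g ⊗ₚ h)

    assoc-natural : A′ ∘ₛ fg-h ≋ f-gh ∘ₛ A
    assoc-natural = instant-natural fg-h f-gh A A′
      (instant-assoc X Y Z) (instant-assoc X′ Y′ Z′)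
      (++-cases _ (++-cases _
        (λ i → trans (trans (cong (target f-gh) (cast-assoc₁ i)) (target-↑ˡ f (g ⊗ₚ h) i))
          (sym (trans (cong (target A′) (trans (target-↑ˡ (f ⊗ₚ g) h _) (cong (_↑ˡ _) (target-↑ˡ f g i))))
            (cast-assoc₁ (target f i)))))
        (λ j → trans (trans (cong (target f-gh) (cast-assoc₂ {length X} j))
            (trans (target-↑ʳ f (g ⊗ₚ h) _) (cong (length X′ ↑ʳ_) (target-↑ˡ g h j))))
          (sym (trans (cong (target A′) (trans (target-↑ˡ (f ⊗ₚ g) h _) (cong (_↑ˡ _) (target-↑ʳ f g j))))
            (cast-assoc₂ {length X′} (target g j))))))
        (λ k → trans (trans (cong (target f-gh) (cast-assoc₃ {length X} k))
            (trans (target-↑ʳ f (g ⊗ₚ h) _) (cong (length X′ ↑ʳ_) (target-↑ʳ g h k))))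
          (sym (trans (cong (target A′) (target-↑ʳ (f ⊗ₚ g) h k))
            (cast-assoc₃ {length X′} (target h k))))))
      (++-cases _ (++-cases _
        (λ i → agree-trans
          (agree-trans (agree-cong f-gh (cast-assoc₁ i)) (agree-↑ˡ f (g ⊗ₚ h) i))
          (agree-sym (agree-trans (agree-↑ˡ (f ⊗ₚ g) h _) (agree-↑ˡ f g i))))
        (λ j → agree-trans
          (agree-trans (agree-cong f-gh (cast-assoc₂ {length X} j))
            (agree-trans (agree-↑ʳ f (g ⊗ₚ h) _) (agree-↑ˡ g h j)))
          (agree-sym (agree-trans (agree-↑ˡ (f ⊗ₚ g) h _) (agree-↑ʳ f g j)))))
        (λ k → agree-trans
          (agree-trans (agree-cong f-gh (cast-assoc₃ {length X} k))
            (agree-trans (agree-↑ʳ f (g ⊗ₚ h) _) (agree-↑ʳ g h k)))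
          (agree-sym (agree-↑ʳ (f ⊗ₚ g) h k))))

  braid-entry : ∀ X Y k → entry (X ⊗ₛ Y) k ≡ entry (Y ⊗ₛ X) (target (braidₛ X Y) k)
  braid-entry X Y = ++-cases _
    (λ i → trans (entry-↑ˡ X Y i)
      (sym (trans (cong (entry (Y ⊗ₛ X)) (braid-↑ˡ X Y i)) (entry-↑ʳ Y X i))))
    (λ j → trans (entry-↑ʳ X Y j)
      (sym (trans (cong (entry (Y ⊗ₛ X)) (braid-↑ʳ X Y j)) (entry-↑ˡ Y X j))))

  instant-braid : ∀ X Y → Instant (braidₛ X Y)
  instant-braid X Y k = cong proj₁ (braid-entry X Y k)

  unitˡ-natural : ∀ {X X′} (f : Pulses X X′) →
                  unitˡₛ X′ ∘ₛ (idₛ {unitₛ} ⊗ₚ f) ≋ f ∘ₛ unitˡₛ X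
  unitˡ-natural {X} {X′} f = instant-natural (idₛ {unitₛ} ⊗ₚ f) f (unitˡₛ X) (unitˡₛ X′)
    (λ _ → refl) (λ _ → refl)
    (λ k → sym (target-↑ʳ (idₛ {unitₛ}) f k))
    (λ k → agree-sym (agree-↑ʳ (idₛ {unitₛ}) f k))

  cast-unitʳ : ∀ {n} (i : Fin n) → cast (ℕₚ.+-identityʳ n) (i ↑ˡ 0) ≡ i
  cast-unitʳ i = toℕ-injective (trans (toℕ-cast _ (i ↑ˡ 0)) (toℕ-↑ˡ i 0))

  unitʳ-natural : ∀ {X X′} (f : Pulses X X′) →
                  unitʳₛ X′ ∘ₛ (f ⊗ₚ idₛ {unitₛ}) ≋ f ∘ₛ unitʳₛ X
  unitʳ-natural {X} {X′} f = instant-natural (f ⊗ₚ idₛ {unitₛ}) f (unitʳₛ X) (unitʳₛ X′)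
    (instant-unitʳ X) (instant-unitʳ X′)
    (++-cases _
      (λ i → trans (cong (target f) (cast-unitʳ i))
        (sym (trans (cong (target (unitʳₛ X′)) (target-↑ˡ f (idₛ {unitₛ}) i)) (cast-unitʳ _))))
      λ ())
    (++-cases _
      (λ i → agree-trans (agree-cong f (cast-unitʳ i)) (agree-sym (agree-↑ˡ f (idₛ {unitₛ}) i)))
      λ ())

  braid-natural : ∀ {X Y X′ Y′} (f : Pulses X X′) (g : Pulses Y Y′) →
                  braidₛ X′ Y′ ∘ₛ (f ⊗ₚ g) ≋ (g ⊗ₚ f) ∘ₛ braidₛ X Y
  braid-natural {X} {Y} {X′} {Y′} f g =
    instant-natural (f ⊗ₚ g) (g ⊗ₚ f) (braidₛ X Y) (braidₛ X′ Y′)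
      (instant-braid X Y) (instant-braid X′ Y′)
      (++-cases _
        (λ i → trans (trans (cong (target (g ⊗ₚ f)) (braid-↑ˡ X Y i)) (target-↑ʳ g f i))
          (sym (trans (cong (target (braidₛ X′ Y′)) (target-↑ˡ f g i)) (braid-↑ˡ X′ Y′ _))))
        (λ j → trans (trans (cong (target (g ⊗ₚ f)) (braid-↑ʳ X Y j)) (target-↑ˡ g f j))
          (sym (trans (cong (target (braidₛ X′ Y′)) (target-↑ʳ f g j)) (braid-↑ʳ X′ Y′ _)))))
      (++-cases _
        (λ i → agree-trans
          (agree-trans (agree-cong (g ⊗ₚ f) (braid-↑ˡ X Y i)) (agree-↑ʳ g f i))
          (agree-sym (agree-↑ˡ f g i)))
        (λ j → agree-trans
          (agree-trans (agree-cong (g ⊗ₚ f) (braid-↑ʳ X Y j)) (agree-↑ˡ g f j))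
          (agree-sym (agree-↑ʳ f g j))))

  braid-symmetric : ∀ X Y → braidₛ Y X ∘ₛ braidₛ X Y ≋ idₛ
  braid-symmetric X Y = instant-≋
    (instant-∘ (braidₛ Y X) (braidₛ X Y) (instant-braid Y X) (instant-braid X Y))
    (++-cases _
      (λ i → trans (cong (target (braidₛ Y X)) (braid-↑ˡ X Y i)) (braid-↑ʳ Y X i))
      (λ j → trans (cong (target (braidₛ Y X)) (braid-↑ʳ X Y j)) (braid-↑ˡ Y X j)))

  module _ (X Y Z : Signal) where
    private
      β₁ = braidₛ X Y ⊗ₚ idₛ {Z}
      β₂ = idₛ {Y} ⊗ₚ braidₛ X Z
      β  = braidₛ X (Y ⊗ₛ Z)

    braid-hexagon : β₂ ∘ₛ (assocₛ Y X Z ∘ₛ β₁) ≋ assocₛ Y Z X ∘ₛ (β ∘ₛ assocₛ X Y Z)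
    braid-hexagon = instant-≋
      (instant-∘ β₂ (assocₛ Y X Z ∘ₛ β₁)
        (instant-⊗ (idₛ {Y}) (braidₛ X Z) (instant-id {Y}) (instant-braid X Z))
        (instant-∘ (assocₛ Y X Z) β₁ (instant-assoc Y X Z)
          (instant-⊗ (braidₛ X Y) (idₛ {Z}) (instant-braid X Y) (instant-id {Z}))))
      (++-cases _ (++-cases _
        (λ i → trans
          (trans (cong (λ k → target β₂ (target (assocₛ Y X Z) k))
              (trans (target-↑ˡ (braidₛ X Y) (idₛ {Z}) _) (cong (_↑ˡ _) (braid-↑ˡ X Y i))))
            (trans (cong (target β₂) (cast-assoc₂ {length Y} i))
              (trans (target-↑ʳ (idₛ {Y}) (braidₛ X Z) _) (cong (length Y ↑ʳ_) (braid-↑ˡ X Z i)))))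
          (sym (trans (cong (λ k → target (assocₛ Y Z X) (target β k)) (cast-assoc₁ i))
            (trans (cong (target (assocₛ Y Z X)) (braid-↑ˡ X (Y ⊗ₛ Z) i)) (cast-assoc₃ {length Y} i)))))
        (λ j → trans
          (trans (cong (λ k → target β₂ (target (assocₛ Y X Z) k))
              (trans (target-↑ˡ (braidₛ X Y) (idₛ {Z}) _) (cong (_↑ˡ _) (braid-↑ʳ X Y j))))
            (trans (cong (target β₂) (cast-assoc₁ j)) (target-↑ˡ (idₛ {Y}) (braidₛ X Z) j)))
          (sym (trans (cong (λ k → target (assocₛ Y Z X) (target β k)) (cast-assoc₂ {length X} j))
            (trans (cong (target (assocₛ Y Z X)) (braid-↑ʳ X (Y ⊗ₛ Z) _)) (cast-assoc₁ j))))))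
        (λ l → trans
          (trans (cong (λ k → target β₂ (target (assocₛ Y X Z) k)) (target-↑ʳ (braidₛ X Y) (idₛ {Z}) l))
            (trans (cong (target β₂) (cast-assoc₃ {length Y} l))
              (trans (target-↑ʳ (idₛ {Y}) (braidₛ X Z) _) (cong (length Y ↑ʳ_) (braid-↑ʳ X Z l)))))
          (sym (trans (cong (λ k → target (assocₛ Y Z X) (target β k)) (cast-assoc₃ {length X} l))
            (trans (cong (target (assocₛ Y Z X)) (braid-↑ʳ X (Y ⊗ₛ Z) _)) (cast-assoc₂ {length Y} l))))))

  stationary-id : ∀ {X} → Stationary (idₛ {X})
  stationary-id k = refl

  stationary-assoc : ∀ X Y Z → Stationary (assocₛ X Y Z)
  stationary-assoc X Y Z = toℕ-cast _

  stationary-unitˡ : ∀ X → Stationary (unitˡₛ X)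
  stationary-unitˡ X k = refl

  assoc-triangle : ∀ X Y → (idₛ {X} ⊗ₚ unitˡₛ Y) ∘ₛ assocₛ X unitₛ Y ≋ unitʳₛ X ⊗ₚ idₛ {Y}
  assoc-triangle X Y = stationary-≋
    (instant-∘ I-λ (assocₛ X unitₛ Y)
      (instant-⊗ (idₛ {X}) (unitˡₛ Y) (instant-id {X}) (λ _ → refl)) (instant-assoc X unitₛ Y))
    (stationary-∘ I-λ (assocₛ X unitₛ Y)
      (stationary-⊗ (idₛ {X}) (unitˡₛ Y) (stationary-id {X}) (stationary-unitˡ Y)) (stationary-assoc X unitₛ Y))
    (stationary-⊗ (unitʳₛ X) (idₛ {Y}) (toℕ-cast _) (stationary-id {Y}))
    where I-λ = idₛ {X} ⊗ₚ unitˡₛ Y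

  module _ (W X Y Z : Signal) where
    private
      a₁ = idₛ {W} ⊗ₚ assocₛ X Y Z
      a₂ = assocₛ W (X ⊗ₛ Y) Z
      a₃ = assocₛ W X Y ⊗ₚ idₛ {Z}
      a₄ = assocₛ W X (Y ⊗ₛ Z)
      a₅ = assocₛ (W ⊗ₛ X) Y Z

    assoc-pentagon : a₁ ∘ₛ (a₂ ∘ₛ a₃) ≋ a₄ ∘ₛ a₅
    assoc-pentagon = stationary-≋
      (instant-∘ a₁ (a₂ ∘ₛ a₃)
        (instant-⊗ (idₛ {W}) (assocₛ X Y Z) (instant-id {W}) (instant-assoc X Y Z))
        (instant-∘ a₂ a₃ (instant-assoc W (X ⊗ₛ Y) Z)
          (instant-⊗ (assocₛ W X Y) (idₛ {Z}) (instant-assoc W X Y) (instant-id {Z}))))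
      (stationary-∘ a₁ (a₂ ∘ₛ a₃)
        (stationary-⊗ (idₛ {W}) (assocₛ X Y Z) (stationary-id {W}) (stationary-assoc X Y Z))
        (stationary-∘ a₂ a₃ (stationary-assoc W (X ⊗ₛ Y) Z)
          (stationary-⊗ (assocₛ W X Y) (idₛ {Z}) (stationary-assoc W X Y) (stationary-id {Z}))))
      (stationary-∘ a₄ a₅ (stationary-assoc W X (Y ⊗ₛ Z)) (stationary-assoc (W ⊗ₛ X) Y Z))

  instant-inverse : ∀ {X Y} (f : Pulses Y X) (g : Pulses X Y) → Instant f → Instant g →
                    (∀ k → target f (target g k) ≡ k) → f ∘ₛ g ≋ idₛ
  instant-inverse f g i j eq = instant-≋ (instant-∘ f g i j) eq

  𝒮 : SymmetricMonoidalCategory 0ℓ 0ℓ 0ℓ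
  𝒮 = record
    { category   = Signalsᶜ
    ; unit       = unitₛ
    ; _⊗₀_       = _⊗ₛ_
    ; _⊗₁_       = _⊗ₚ_
    ; ⊗-resp-≈   = ⊗-resp
    ; ⊗-id       = λ {X} {Y} → stationary-≋
        (instant-⊗ (idₛ {X}) (idₛ {Y}) (instant-id {X}) (instant-id {Y}))
        (stationary-⊗ (idₛ {X}) (idₛ {Y}) (stationary-id {X}) (stationary-id {Y}))
        (stationary-id {X ⊗ₛ Y})
    ; ⊗-∘        = ⊗-∘ₛ
    ; associator = λ X Y Z → record
        { to   = assocₛ X Y Z
        ; from = assocₛ⁻¹ X Y Z
        ; isoˡ = instant-inverse (assocₛ⁻¹ X Y Z) (assocₛ X Y Z)
            (instant-assoc⁻¹ X Y Z) (instant-assoc X Y Z)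
            (λ _ → Perm.inverseˡ (σ (assocₛ X Y Z)))
        ; isoʳ = instant-inverse (assocₛ X Y Z) (assocₛ⁻¹ X Y Z)
            (instant-assoc X Y Z) (instant-assoc⁻¹ X Y Z)
            (λ _ → Perm.inverseʳ (σ (assocₛ X Y Z)))
        }
    ; unitorˡ    = λ X → record
        { to   = unitˡₛ X
        ; from = unitˡₛ⁻¹ X
        ; isoˡ = instant-inverse (unitˡₛ⁻¹ X) (unitˡₛ X) (λ _ → refl) (λ _ → refl) (λ _ → refl)
        ; isoʳ = instant-inverse (unitˡₛ X) (unitˡₛ⁻¹ X) (λ _ → refl) (λ _ → refl) (λ _ → refl)
        }
    ; unitorʳ    = λ X → record
        { to   = unitʳₛ X
        ; from = unitʳₛ⁻¹ X
        ; isoˡ = instant-inverse (unitʳₛ⁻¹ X) (unitʳₛ X)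
            (instant-unitʳ⁻¹ X) (instant-unitʳ X)
            (λ _ → Perm.inverseˡ (σ (unitʳₛ X)))
        ; isoʳ = instant-inverse (unitʳₛ X) (unitʳₛ⁻¹ X)
            (instant-unitʳ X) (instant-unitʳ⁻¹ X)
            (λ _ → Perm.inverseʳ (σ (unitʳₛ X)))
        }
    ; braiding   = braidₛ
    ; α-natural  = assoc-natural _ _ _
    ; λ-natural  = unitˡ-natural _
    ; ρ-natural  = unitʳ-natural _
    ; braiding-natural = braid-natural _ _
    ; triangle   = assoc-triangle _ _
    ; pentagon   = assoc-pentagon _ _ _ _
    ; symmetric  = braid-symmetric _ _
    ; hexagon    = braid-hexagon _ _ _
    }

  ----------------------------------------------------------------------
  -- Shifts and delays

  shift : ℝ → Signal → Signal
  shift x X = signal (λ k → start X k + x , channel X k)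

  shiftₚ : ∀ x {X Y} → Pulses X Y → Pulses (shift x X) (shift x Y)
  shiftₚ x f = record
    { σ         = σ f
    ; channel-≡ = channel-≡ f
    ; start-≤   = λ k → +-monoˡ-≤ x (start-≤ f k)
    ; pulse     = λ k u s+x≤u u<t+x →
        pulse f k (u - x) (x+y≤z⇒x≤z-y s+x≤u) (x<y+z⇒x-z<y u<t+x)
    }

  -- On a one-element sequence the permutation is e ∈ S₁ and there is one
  -- pulse, the zero function.

  delayₛ : ∀ x → 0# ≤ x → ∀ X → Pulses (shift (- x) X) X
  delayₛ x 0≤x X = record
    { σ         = Perm.id
    ; channel-≡ = λ _ → refl
    ; start-≤   = λ k → 0≤y⇒x-y≤x (start X k) 0≤x
    ; pulse     = λ _ _ _ _ → 0#
    }

  no-negative-delay : ∀ {x} → x < 0# → ∀ t c →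
    let X = signal {1} (λ _ → t , c) in ¬ Pulses (shift (- x) X) X
  no-negative-delay x<0 t c f = <⇒≱ x<0 (x-y≤x⇒0≤y t (start-≤ f zero))

module _ (R : RealNumbers) {Q : Set} (𝐆 : GateSet R Q) (C : Set) where
  open RealNumbers R
  open GateSet 𝐆
  open Signals R C
  open SymmetricMonoidalCategory 𝒮 using (⨂)

  PulseRepresentation : (Q → Signal) → Set
  PulseRepresentation X = ∀ G →
    Pulses (shift (- duration G) (⨂ (Vector.map X (qubits G))))
           (⨂ (Vector.map X (qubits G)))

  signalModel : (X : Q → Signal) → PulseRepresentation X → ModelData R 𝐆 𝒮
  signalModel X f = record
    { X      = X
    ; shift₀ = shift
    ; shift₁ = shiftₚ
    ; gate   = f
    ; delay  = λ x 0≤x q → delayₛ x 0≤x (X q)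
    }

{-# OPTIONS --safe #-}

-- Every structure isomorphism of Shift matches entries whose starting times
-- are equal by a field law, so all of its pulses are empty.  Two such
-- morphisms agree as soon as their permutations do, which settles the
-- coherence laws; nontrivial pulses occur only in functoriality and in the
-- naturality squares, where both sides reparametrise the same pulse.

module Submission where

open import Defs

open import Algebra.Bundles using (AbelianGroup)
import Algebra.Properties.AbelianGroup as AbelianGroupProperties
open import Algebra.Structures using (module IsCommutativeRing)
open import Data.Empty using (⊥-elim)
open import Data.Fin.Base using (splitAt)
import Data.Fin.Permutation as Perm
open import Data.Product.Base using (_×_; _,_; proj₁)
open import Data.Sum.Base using (inj₁; inj₂)
open import Data.Vec.Functional using (Vector)
open import Level using (0ℓ)
open import Relation.Binary.PropositionalEquality
  using (_≡_; refl; sym; trans; cong; subst)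
open import Relation.Nullary using (Dec; yes; no)

-- Additive identities and translation of strict inequalities

module RealProperties (R : RealNumbers) where
  open RealNumbers R

  +-abelianGroup : AbelianGroup 0ℓ 0ℓ
  +-abelianGroup = record
    { isAbelianGroup = IsCommutativeRing.+-isAbelianGroup isCommutativeRing }

  open AbelianGroupProperties +-abelianGroup using (ε⁻¹≈ε; ⁻¹-∙-comm)

  x-0≡x : ∀ x → x - 0# ≡ x
  x-0≡x x = trans (cong (x +_) ε⁻¹≈ε) (+-identityʳ x)

  x-y-z≡x-[y+z] : ∀ x y z → (x - y) - z ≡ x - (y + z)
  x-y-z≡x-[y+z] x y z = trans (+-assoc x (- y) (- z)) (cong (x +_) (⁻¹-∙-comm y z))

  -- The summands swap because shifting by `y` and then by `x` gives a start `(t + y) + x`, while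
  -- the shift by the sum gives `t + (x + y)`.
  x+y+z≡x+[z+y] : ∀ x y z → (x + y) + z ≡ x + (z + y)
  x+y+z≡x+[z+y] x y z = trans (+-assoc x y z) (cong (x +_) (+-comm y z))

  -- Converse of `x<y+z⇒x-z<y`. Together they show that the case split in a composite pulse is
  -- invariant under translation.
  x-y<z⇒x<z+y : ∀ {x y z} → x - y < z → x < z + y
  x-y<z⇒x<z+y {x} {y} {z} (x-y≤z , x-y≢z) =
    subst (_≤ z + y) ([x-y]+y≡x x y) (+-monoˡ-≤ y x-y≤z) ,
    λ eq → x-y≢z (trans (cong (_- y) eq) ([x+y]-y≡x z y))

module ShiftProperties (R : RealNumbers) (C : Set) where
  open RealNumbers R
  open RealProperties R
  open Signals R C
  open Signal
  open Pulses
  open _≋_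
  open Agree
  open SymmetricMonoidalCategory 𝒮 using (Iso)
  open Endofunctors 𝒮

  -- Functoriality of a single shift

  instant-shift : ∀ x {X Y} (f : Pulses X Y) → Instant f → Instant (shiftₚ x f)
  instant-shift x f i k = cong (_+ x) (i k)

  -- Both intervals are translated by the same `x`, and both shifted pulses at `u` read the original
  -- ones at `u - x`.
  agree-shift : ∀ x {X Y X′ Y′} {f : Pulses X Y} {k} {g : Pulses X′ Y′} {l} →
                Agree f k g l → Agree (shiftₚ x f) k (shiftₚ x g) l
  agree-shift x a = record
    { start-eq = cong (_+ x) (start-eq a)
    ; end-eq   = cong (_+ x) (end-eq a)
    ; pulse-eq = λ u _ _ _ _ → pulse-eq a (u - x) _ _ _ _
    }

  -- Serves to compare pulses sampled at points that are equal only by a field law; the interval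
  -- bounds are irrelevant and need no transport.
  pulse-congᵘ : ∀ {X Y} (f : Pulses X Y) k {u v} → u ≡ v →
                ∀ .p .q .p′ .q′ → pulse f k u p q ≡ pulse f k v p′ q′
  pulse-congᵘ f k refl _ _ _ _ = refl

  shift-resp-≋ : ∀ x {X Y} {f g : Pulses X Y} → f ≋ g → shiftₚ x f ≋ shiftₚ x g
  shift-resp-≋ x f≋g = agree-≋ (σ-≡ f≋g) (λ k → agree-shift x (≋-agree f≋g k))

  shift-id : ∀ x {X} → shiftₚ x (idₛ {X}) ≋ idₛ
  shift-id x {X} = instant-≋ (instant-shift x (idₛ {X}) (instant-id {X})) (λ _ → refl)

  -- Unlike in `splice-cong`, the sampling point may change along with the splitting point, so
  -- equality of splitting points gives way to equivalence of the two tests, which rules out the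
  -- mixed cases.
  splice-resp : ∀ {u s u′ s′} (d : Dec (u < s)) (d′ : Dec (u′ < s′)) →
                (u < s → u′ < s′) → (u′ < s′ → u < s) →
                {ψ : .(u < s) → ℝ} {ψ′ : .(u′ < s′) → ℝ}
                {φ : .(s ≤ u) → ℝ} {φ′ : .(s′ ≤ u′) → ℝ} →
                (∀ .p .p′ → ψ p ≡ ψ′ p′) → (∀ .p .p′ → φ p ≡ φ′ p′) →
                splice d ψ φ ≡ splice d′ ψ′ φ′
  splice-resp (yes p) (yes p′) to from ψ≡ φ≡ = ψ≡ p p′
  splice-resp (yes p) (no p′)  to from ψ≡ φ≡ = ⊥-elim (p′ (to p))
  splice-resp (no p)  (yes p′) to from ψ≡ φ≡ = ⊥-elim (p (from p′))
  splice-resp (no p)  (no p′)  to from ψ≡ φ≡ = φ≡ (≮⇒≥ p) (≮⇒≥ p′)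

  -- The left side tests `u - x < s`, the right side `u < s + x`. The tests are equivalent, and on
  -- each branch both sides are the same pulse evaluated at `u - x`.
  shift-∘ : ∀ x {X Y Z} (g : Pulses Y Z) (f : Pulses X Y) →
            shiftₚ x (g ∘ₛ f) ≋ shiftₚ x g ∘ₛ shiftₚ x f
  shift-∘ x g f = mk≋ (λ _ → refl) λ k u _ _ _ →
    splice-resp ((u - x) <? _) (u <? _) x-y<z⇒x<z+y x<y+z⇒x-z<y (λ _ _ → refl) (λ _ _ → refl)

  -- Monoidal structure of a single shift

  module _ {n} {v w : Vector (ℝ × C) n} (eq : ∀ k → v k ≡ w k) where

    -- Shifts keep lengths and positions definitionally, so the identity permutation underlies every
    -- structure isomorphism and both round trips fix each position by `refl`.
    relabel-iso : Iso (signal v) (signal w)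
    relabel-iso = record
      { to   = to
      ; from = from
      ; isoˡ = instant-inverse from to instant-from instant-to (λ _ → refl)
      ; isoʳ = instant-inverse to from instant-to instant-from (λ _ → refl)
      }
      where
        to : Pulses (signal v) (signal w)
        to = relabel Perm.id eq

        from : Pulses (signal w) (signal v)
        from = relabel Perm.id (λ k → sym (eq k))

        instant-to : Instant to
        instant-to k = cong proj₁ (eq k)

        instant-from : Instant from
        instant-from k = cong proj₁ (sym (eq k))

  module _ (x : ℝ) where

    shift-ε : Iso unitₛ (shift x unitₛ)
    shift-ε = relabel-iso λ ()

    module _ (X Y : Signal) where
      shift-⊗-entry : ∀ k → entry (shift x X ⊗ₛ shift x Y) k ≡ entry (shift x (X ⊗ₛ Y)) k
      -- Lookup in a concatenation is stuck on `splitAt`; once the block is known, both sides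
      -- compute to the same shifted entry.
      shift-⊗-entry k with splitAt (length X) k
      ... | inj₁ i = refl
      ... | inj₂ j = refl

      shift-μ : Iso (shift x X ⊗ₛ shift x Y) (shift x (X ⊗ₛ Y))
      shift-μ = relabel-iso shift-⊗-entry

      μₛ : Pulses (shift x X ⊗ₛ shift x Y) (shift x (X ⊗ₛ Y))
      μₛ = Iso.to shift-μ

      instant-μ : Instant μₛ
      instant-μ k = cong proj₁ (shift-⊗-entry k)

    -- This is the content of the naturality of `μₛ`: since `μₛ` fixes positions, it suffices to
    -- compare pulses at the same `k`, block by block.
    shift-⊗-agree : ∀ {X Y X′ Y′} (f : Pulses X X′) (g : Pulses Y Y′) k →
                    Agree (shiftₚ x (f ⊗ₚ g)) k (shiftₚ x f ⊗ₚ shiftₚ x g) k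
    shift-⊗-agree f g = ++-cases _
      (λ i → agree-trans (agree-shift x (agree-↑ˡ f g i))
        (agree-sym (agree-↑ˡ (shiftₚ x f) (shiftₚ x g) i)))
      (λ j → agree-trans (agree-shift x (agree-↑ʳ f g j))
        (agree-sym (agree-↑ʳ (shiftₚ x f) (shiftₚ x g) j)))

    -- Every factor has empty pulses and fixes positions. Emptiness is checked on the left only:
    -- equal targets give both sides the same intervals.
    shift-associativity : ∀ X Y Z →
      shiftₚ x (assocₛ X Y Z) ∘ₛ μₛ (X ⊗ₛ Y) Z ∘ₛ (μₛ X Y ⊗ₚ idₛ {shift x Z})
        ≋ μₛ X (Y ⊗ₛ Z) ∘ₛ (idₛ {shift x X} ⊗ₚ μₛ Y Z) ∘ₛ assocₛ (shift x X) (shift x Y) (shift x Z)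
    shift-associativity X Y Z = stationary-≋
      (instant-∘ a (b ∘ₛ c) (instant-shift x (assocₛ X Y Z) (instant-assoc X Y Z))
        (instant-∘ b c (instant-μ (X ⊗ₛ Y) Z)
          (instant-⊗ (μₛ X Y) (idₛ {shift x Z}) (instant-μ X Y) (instant-id {shift x Z}))))
      (stationary-∘ a (b ∘ₛ c) (stationary-assoc X Y Z)
        (stationary-∘ b c (λ _ → refl)
          (stationary-⊗ (μₛ X Y) (idₛ {shift x Z}) (λ _ → refl) (λ _ → refl))))
      (stationary-∘ a′ (b′ ∘ₛ c′) (λ _ → refl)
        (stationary-∘ b′ c′
          (stationary-⊗ (idₛ {shift x X}) (μₛ Y Z) (λ _ → refl) (λ _ → refl))
          (stationary-assoc (shift x X) (shift x Y) (shift x Z))))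
      where
        a  = shiftₚ x (assocₛ X Y Z)
        b  = μₛ (X ⊗ₛ Y) Z
        c  = μₛ X Y ⊗ₚ idₛ {shift x Z}
        a′ = μₛ X (Y ⊗ₛ Z)
        b′ = idₛ {shift x X} ⊗ₚ μₛ Y Z
        c′ = assocₛ (shift x X) (shift x Y) (shift x Z)

    shift-unitaryˡ : ∀ X →
      shiftₚ x (unitˡₛ X) ∘ₛ μₛ unitₛ X ∘ₛ (Iso.to shift-ε ⊗ₚ idₛ {shift x X}) ≋ unitˡₛ (shift x X)
    shift-unitaryˡ X = stationary-≋
      (instant-∘ (shiftₚ x (unitˡₛ X)) (b ∘ₛ c) (λ _ → refl)
        (instant-∘ b c (instant-μ unitₛ X)
          (instant-⊗ (Iso.to shift-ε) (idₛ {shift x X}) (λ ()) (instant-id {shift x X}))))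
      (stationary-∘ (shiftₚ x (unitˡₛ X)) (b ∘ₛ c) (λ _ → refl)
        (stationary-∘ b c (λ _ → refl)
          (stationary-⊗ (Iso.to shift-ε) (idₛ {shift x X}) (λ ()) (λ _ → refl))))
      (stationary-unitˡ (shift x X))
      where
        b = μₛ unitₛ X
        c = Iso.to shift-ε ⊗ₚ idₛ {shift x X}

    shift-unitaryʳ : ∀ X →
      shiftₚ x (unitʳₛ X) ∘ₛ μₛ X unitₛ ∘ₛ (idₛ {shift x X} ⊗ₚ Iso.to shift-ε) ≋ unitʳₛ (shift x X)
    shift-unitaryʳ X = stationary-≋
      (instant-∘ a (b ∘ₛ c) (instant-shift x (unitʳₛ X) (instant-unitʳ X))
        (instant-∘ b c (instant-μ X unitₛ)
          (instant-⊗ (idₛ {shift x X}) (Iso.to shift-ε) (instant-id {shift x X}) (λ ()))))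
      (stationary-∘ a (b ∘ₛ c) (stationary-unitʳ X)
        (stationary-∘ b c (λ _ → refl)
          (stationary-⊗ (idₛ {shift x X}) (Iso.to shift-ε) (λ _ → refl) (λ ()))))
      (stationary-unitʳ (shift x X))
      where
        a = shiftₚ x (unitʳₛ X)
        b = μₛ X unitₛ
        c = idₛ {shift x X} ⊗ₚ Iso.to shift-ε

        -- `shiftₚ` leaves the permutation unchanged, so this also covers the shifted unitor `a`.
        stationary-unitʳ : ∀ Y → Stationary (unitʳₛ Y)
        stationary-unitʳ Y = stationary-cast {Y ⊗ₛ unitₛ} {Y} _ (unitʳ-entry Y)

    -- The braiding moves positions, so `stationary-≋` does not apply. But its permutation depends
    -- only on lengths, which shifts preserve, so the targets coincide definitionally.
    shift-symmetry : ∀ X Y →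
      shiftₚ x (braidₛ X Y) ∘ₛ μₛ X Y ≋ μₛ Y X ∘ₛ braidₛ (shift x X) (shift x Y)
    shift-symmetry X Y = instant-≋
      (instant-∘ (shiftₚ x (braidₛ X Y)) (μₛ X Y)
        (instant-shift x (braidₛ X Y) (instant-braid X Y)) (instant-μ X Y))
      (λ _ → refl)

    shift-isSymmetricMonoidalEndofunctor :
      IsSymmetricMonoidalEndofunctor (shift x) (shiftₚ x)
    shift-isSymmetricMonoidalEndofunctor = record
      { F-resp-≈      = shift-resp-≋ x
      ; identity      = shift-id x
      ; homomorphism  = λ {_} {_} {_} {f} {g} → shift-∘ x g f
      ; ε-iso         = shift-ε
      ; μ-iso         = shift-μ
      ; μ-natural     = λ {X} {Y} {X′} {Y′} {f} {g} →
          instant-natural (shiftₚ x f ⊗ₚ shiftₚ x g) (shiftₚ x (f ⊗ₚ g)) (μₛ X Y) (μₛ X′ Y′)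
            (instant-μ X Y) (instant-μ X′ Y′) (λ _ → refl) (shift-⊗-agree f g)
      ; associativity = λ {X} {Y} {Z} → shift-associativity X Y Z
      ; unitaryˡ      = λ {X} → shift-unitaryˡ X
      ; unitaryʳ      = λ {X} → shift-unitaryʳ X
      ; symmetry      = λ {X} {Y} → shift-symmetry X Y
      }

  Shiftₛ : ℝ → SymmetricMonoidalEndofunctor
  Shiftₛ x = record
    { isSymmetricMonoidalEndofunctor = shift-isSymmetricMonoidalEndofunctor x }

  -- Comparison of the identity with the zero shift

  shift-0-entry : ∀ X k → entry X k ≡ entry (shift 0# X) k
  shift-0-entry X k = cong (_, channel X k) (sym (+-identityʳ (start X k)))

  shift-0-iso : ∀ X → Iso X (shift 0# X)
  shift-0-iso X = relabel-iso (shift-0-entry X)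

  ιₛ : ∀ X → Pulses X (shift 0# X)
  ιₛ X = Iso.to (shift-0-iso X)

  instant-ι : ∀ X → Instant (ιₛ X)
  instant-ι X k = cong proj₁ (shift-0-entry X k)

  shift-0-agree : ∀ {X Y} (f : Pulses X Y) k → Agree (shiftₚ 0# f) k f k
  shift-0-agree f k = record
    { start-eq = +-identityʳ _
    ; end-eq   = +-identityʳ _
    ; pulse-eq = λ u _ _ _ _ → pulse-congᵘ f k (x-0≡x u) _ _ _ _
    }

  shift-0 : MonoidalNaturalIso idF (Shiftₛ 0#)
  shift-0 = record
    { component = shift-0-iso
    ; natural   = λ {X} {Y} {f} → instant-natural f (shiftₚ 0# f) (ιₛ X) (ιₛ Y)
        (instant-ι X) (instant-ι Y) (λ _ → refl) (shift-0-agree f)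
    ; ε-compat  = mk≋ (λ ()) (λ ())
    -- The factor `idₛ` is the multiplication of `idF`.
    ; μ-compat  = λ {X} {Y} → stationary-≋
        (instant-∘ (ιₛ (X ⊗ₛ Y)) idₛ (instant-ι (X ⊗ₛ Y)) (instant-id {X ⊗ₛ Y}))
        (λ _ → refl)
        (stationary-∘ (μₛ 0# X Y) (ιₛ X ⊗ₚ ιₛ Y) (λ _ → refl)
          (stationary-⊗ (ιₛ X) (ιₛ Y) (λ _ → refl) (λ _ → refl)))
    }

  -- Comparison of composite shifts with the shift by a sum

  module _ (x y : ℝ) where
    shift-+-entry : ∀ X k → entry (shift x (shift y X)) k ≡ entry (shift (x + y) X) k
    shift-+-entry X k = cong (_, channel X k) (x+y+z≡x+[z+y] (start X k) y x)

    shift-+-iso : ∀ X → Iso (shift x (shift y X)) (shift (x + y) X)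
    shift-+-iso X = relabel-iso (shift-+-entry X)

    κₛ : ∀ X → Pulses (shift x (shift y X)) (shift (x + y) X)
    κₛ X = Iso.to (shift-+-iso X)

    instant-κ : ∀ X → Instant (κₛ X)
    instant-κ X k = cong proj₁ (shift-+-entry X k)

    -- The iterated shift reads `f` at `(u - x) - y`, the single one at `u - (x + y)`.
    shift-+-agree : ∀ {X Y} (f : Pulses X Y) k →
                    Agree (shiftₚ (x + y) f) k (shiftₚ x (shiftₚ y f)) k
    shift-+-agree f k = record
      { start-eq = sym (x+y+z≡x+[z+y] _ y x)
      ; end-eq   = sym (x+y+z≡x+[z+y] _ y x)
      ; pulse-eq = λ u _ _ _ _ → pulse-congᵘ f k (sym (x-y-z≡x-[y+z] u x y)) _ _ _ _
      }

    shift-+-natural : ∀ {X Y} (f : Pulses X Y) →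
                      κₛ Y ∘ₛ shiftₚ x (shiftₚ y f) ≋ shiftₚ (x + y) f ∘ₛ κₛ X
    shift-+-natural {X} {Y} f =
      instant-natural (shiftₚ x (shiftₚ y f)) (shiftₚ (x + y) f) (κₛ X) (κₛ Y)
        (instant-κ X) (instant-κ Y) (λ _ → refl) (shift-+-agree f)

    -- `μxy` is the multiplication of the composite functor, unfolded.
    shift-+-μ : ∀ X Y → let μxy = shiftₚ x (μₛ y X Y) ∘ₛ μₛ x (shift y X) (shift y Y) in
                κₛ (X ⊗ₛ Y) ∘ₛ μxy ≋ μₛ (x + y) X Y ∘ₛ (κₛ X ⊗ₚ κₛ Y)
    shift-+-μ X Y = stationary-≋
      (instant-∘ (κₛ (X ⊗ₛ Y)) (μy ∘ₛ μx) (instant-κ (X ⊗ₛ Y))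
        (instant-∘ μy μx (instant-shift x (μₛ y X Y) (instant-μ y X Y))
          (instant-μ x (shift y X) (shift y Y))))
      (λ _ → refl)
      (stationary-∘ (μₛ (x + y) X Y) (κₛ X ⊗ₚ κₛ Y) (λ _ → refl)
        (stationary-⊗ (κₛ X) (κₛ Y) (λ _ → refl) (λ _ → refl)))
      where
        μx = μₛ x (shift y X) (shift y Y)
        μy = shiftₚ x (μₛ y X Y)

  -- Coherence of the comparisons in the real argument

  alongₛ : ∀ {x y} → x ≡ y → ∀ X → Pulses (shift x X) (shift y X)
  alongₛ {x} eq X = subst (λ y → Pulses (shift x X) (shift y X)) eq idₛ

  -- Transport along a field law does not compute; stated for an arbitrary equation, it reduces to
  -- `idₛ` by matching on `refl`.
  instant-along : ∀ {x y} (eq : x ≡ y) X → Instant (alongₛ eq X)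
  instant-along {x} refl X = instant-id {shift x X}

  stationary-along : ∀ {x y} (eq : x ≡ y) X → Stationary (alongₛ eq X)
  stationary-along {x} refl X = stationary-id {shift x X}

  -- Both sides have empty pulses and fix positions; the transport is the only factor that does not
  -- fix them by `refl`. The two unit laws below follow the same pattern.
  shift-assoc : ∀ x y z X →
    alongₛ (+-assoc x y z) X ∘ₛ κₛ (x + y) z X ∘ₛ κₛ x y (shift z X)
      ≋ κₛ x (y + z) X ∘ₛ shiftₚ x (κₛ y z X)
  shift-assoc x y z X = stationary-≋
    (instant-∘ a (b ∘ₛ c) (instant-along (+-assoc x y z) X)
      (instant-∘ b c (instant-κ (x + y) z X) (instant-κ x y (shift z X))))
    (stationary-∘ a (b ∘ₛ c) (stationary-along (+-assoc x y z) X) (λ _ → refl))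
    (λ _ → refl)
    where
      a = alongₛ (+-assoc x y z) X
      b = κₛ (x + y) z X
      c = κₛ x y (shift z X)

  shift-identityˡ : ∀ x X →
    alongₛ (+-identityˡ x) X ∘ₛ κₛ 0# x X ∘ₛ ιₛ (shift x X) ≋ idₛ
  shift-identityˡ x X = stationary-≋
    (instant-∘ a (b ∘ₛ c) (instant-along (+-identityˡ x) X)
      (instant-∘ b c (instant-κ 0# x X) (instant-ι (shift x X))))
    (stationary-∘ a (b ∘ₛ c) (stationary-along (+-identityˡ x) X) (λ _ → refl))
    (λ _ → refl)
    where
      a = alongₛ (+-identityˡ x) X
      b = κₛ 0# x X
      c = ιₛ (shift x X)

  shift-identityʳ : ∀ x X →
    alongₛ (+-identityʳ x) X ∘ₛ κₛ x 0# X ∘ₛ shiftₚ x (ιₛ X) ≋ idₛ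
  shift-identityʳ x X = stationary-≋
    (instant-∘ a (b ∘ₛ c) (instant-along (+-identityʳ x) X)
      (instant-∘ b c (instant-κ x 0# X) (instant-shift x (ιₛ X) (instant-ι X))))
    (stationary-∘ a (b ∘ₛ c) (stationary-along (+-identityʳ x) X) (λ _ → refl))
    (λ _ → refl)
    where
      a = alongₛ (+-identityʳ x) X
      b = κₛ x 0# X
      c = shiftₚ x (ιₛ X)

proposition11 : (R : RealNumbers) (Q : Set) (𝐆 : GateSet R Q) (C : Set)
    (X : Q → Signals.Signal R C) (f : PulseRepresentation R 𝐆 C X) →
    IsCategoricalModel R 𝐆 (Signals.𝒮 R C) (signalModel R 𝐆 C X f)
proposition11 R Q 𝐆 C X f = record
  { isSymmetricMonoidalEndofunctor = shift-isSymmetricMonoidalEndofunctor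
  ; Shift-0         = shift-0
  -- Given by its fields because comparing two composite functors for
  -- definitional equality unfolds all of their coherence proofs.
  ; Shift-+         = λ x y → record
    { component = shift-+-iso x y
    ; natural   = λ {_} {_} {f} → shift-+-natural x y f
    ; ε-compat  = mk≋ (λ ()) (λ ())
    ; μ-compat  = λ {X} {Y} → shift-+-μ x y X Y
    }
  ; Shift-assoc     = shift-assoc
  ; Shift-identityˡ = shift-identityˡ
  ; Shift-identityʳ = shift-identityʳ
  }
  where
  open Signals R C using (mk≋)
  open ShiftProperties R C
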